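{- For every integer $n\ge 0$, \[ \binom{2n}{n}^3 = [(xyzt)^n]\,\frac{1}{1-(x+y)(1-4zt)-z-t}= [(xyzt)^n]\,\frac{1}{\det(I-\mathrm{diag}(x,y,z,t)M)}, \] where $I$ is the $4\times 4$ identity matrix, $\mathrm{diag}(x,y,z,t)$ is the $4\times 4$ diagonal matrix with diagonal entries $x,y,z,t$ (in this order), and \[ M=\begin{bmatrix} 1 & 1 & 1 & 1\\ 1 & 1 & 1 & 1\\ 1 & 1 & 1 & -1\\ 1 & 1 & -1 & 1 \end{bmatrix}. \]
   Context: Here $x,y,z,t$ are indeterminates over $\mathbb{C}$. For a rational function $f=P/Q\in\mathbb{C}(x_1,\dots,x_m)$ with $Q(0,\dots,0)\ne 0$, $[x_1^{\alpha_1}\cdots x_m^{\alpha_m}]f$ denotes the coefficient of $x_1^{\alpha_1}\cdots x_m^{\alpha_m}$ in the Taylor (formal power) series expansion of $f$ around $(0,\dots,0)$. In particular $[(xyzt)^n]$ extracts the coefficient of $x^ny^nz^nt^n$. -}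

module Defs where

open import Algebra.Apartness.Bundles using (HeytingField; HeytingCommutativeRing)
open import Algebra.Bundles using (RawRing; Semiring; CommutativeRing)
open import Data.Bool.Base using (true; false; if_then_else_)
open import Data.Fin.Base as Fin using (Fin; toℕ; punchIn)
open import Data.Fin.Patterns using (0F; 1F; 2F; 3F)
open import Data.Fin.Properties as Fin using (toℕ≤pred[n])
open import Data.Nat.Base as ℕ using (ℕ; zero; suc; _≤_; _<_; z≤n; s≤s)
import Data.Nat.Properties as ℕ
open import Data.Product.Base using (_,_; proj₁; proj₂)
open import Data.Vec.Base using (Vec; []; _∷_; lookup; replicate; zipWith; _[_]≔_)
import Data.Vec.Base as Vec
open import Data.Vec.Properties using (≡-dec)
open import Function.Base using (_∘_)
open import Relation.Binary.PropositionalEquality as ≡ using (_≡_)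
open import Relation.Nullary.Decidable.Core using (does)

module Matrices {r ℓ} (R : RawRing r ℓ) where
  open RawRing R
  open import Algebra.Definitions.RawSemiring rawSemiring using (sum; _^_)

  Matrix : ℕ → Set r
  Matrix n = Fin n → Fin n → Carrier

  diag : ∀ {n} → (Fin n → Carrier) → Matrix n
  diag v i j = if does (i Fin.≟ j) then v i else 0#

  identity : ∀ {n} → Matrix n
  identity = diag (λ _ → 1#)

  infixl 7 _⊗_
  infixl 6 _⊖_

  _⊗_ : ∀ {n} → Matrix n → Matrix n → Matrix n
  (A ⊗ B) i j = sum (λ k → A i k * B k j)

  _⊖_ : ∀ {n} → Matrix n → Matrix n → Matrix n
  (A ⊖ B) i j = A i j + - B i j

  -- Laplace expansion along the first row.
  det : ∀ {n} → Matrix n → Carrier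
  det {zero}  A = 1#
  det {suc n} A =
    sum (λ j → (- 1#) ^ toℕ j * (A 0F j * det (λ i k → A (Fin.suc i) (punchIn j k))))

  M : Matrix 4
  M i j = lookup (lookup
    ( (1# ∷ 1# ∷ 1#   ∷ 1#   ∷ [])
    ∷ (1# ∷ 1# ∷ 1#   ∷ 1#   ∷ [])
    ∷ (1# ∷ 1# ∷ 1#   ∷ - 1# ∷ [])
    ∷ (1# ∷ 1# ∷ - 1# ∷ 1#   ∷ [])
    ∷ []) i) j

-- Formal power series in m indeterminates over a field K, which is arbitrary:
-- the coefficient field ℂ is one instance.  For a Heyting field, "≠ 0" is
-- apartness from 0#.
module PowerSeries {c ℓ₁ ℓ₂} (K : HeytingField c ℓ₁ ℓ₂) where
  open HeytingField K public
    using (Carrier; _≈_; _#_; _+_; _*_; -_; _-_; 0#; 1#)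
  open HeytingField K using (heytingCommutativeRing; #⇒invertible)
  open HeytingCommutativeRing heytingCommutativeRing using (commutativeRing)
  open CommutativeRing commutativeRing using
    ( setoid; refl; sym; trans; reflexive
    ; +-congˡ; +-congʳ; +-cong; *-congˡ; *-congʳ; *-cong; -‿cong
    ; +-identityˡ; +-identityʳ; *-identityˡ; -‿inverseˡ; -‿inverseʳ
    ; +-assoc; +-comm; *-assoc; *-comm; zeroˡ; zeroʳ; distribʳ
    ; semiring; ring; +-commutativeMonoid; +-abelianGroup; +-commutativeSemigroup)
  open Semiring semiring using (rawSemiring)
  open import Algebra.Definitions.RawSemiring rawSemiring public using (_×_)
  open import Algebra.Definitions.RawSemiring rawSemiring using (sum)

  Series : ℕ → Set c
  Series m = Vec ℕ m → Carrier

  coeff : ∀ {m} → Vec ℕ m → Series m → Carrier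
  coeff α f = f α

  slice : ∀ {m} → (Vec ℕ (suc m) → Vec ℕ (suc m) → Carrier) →
          ∀ a → Fin (suc a) → Vec ℕ m → Vec ℕ m → Carrier
  slice F a i β γ = F (toℕ i ∷ β) (a ℕ.∸ toℕ i ∷ γ)

  -- ∑⟨ α ⟩ F is the sum of F β γ over all pairs of exponent vectors with
  -- β + γ = α.
  ∑⟨_⟩ : ∀ {m} → Vec ℕ m → (Vec ℕ m → Vec ℕ m → Carrier) → Carrier
  ∑⟨ [] ⟩    F = F [] []
  ∑⟨ a ∷ α ⟩ F = sum {suc a} (λ i → ∑⟨ α ⟩ (slice F a i))

  𝟎 : ∀ {m} → Vec ℕ m
  𝟎 = replicate _ 0

  monomial : ∀ {m} → Vec ℕ m → Series m
  monomial α β = if does (≡-dec ℕ._≟_ α β) then 1# else 0#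

  seriesRawRing : ℕ → RawRing c ℓ₁
  seriesRawRing m = record
    { Carrier = Series m
    ; _≈_     = λ f g → ∀ α → f α ≈ g α
    ; _+_     = λ f g α → f α + g α
    ; _*_     = λ f g α → ∑⟨ α ⟩ (λ β γ → f β * g γ)
    ; -_      = λ f α → - f α
    ; 0#      = λ _ → 0#
    ; 1#      = monomial 𝟎
    }

  module Ser {m : ℕ} where
    open RawRing (seriesRawRing m) public
    open import Algebra.Definitions.RawSemiring
      (RawRing.rawSemiring (seriesRawRing m)) public using (_×_; _^_; sum)

  var : ∀ {m} → Fin m → Series m
  var i = monomial (𝟎 [ i ]≔ 1)

  -- The power series expansion of 1 / Q for Q(0) ≠ 0, with Q given by its own
  -- expansion; Q*1/Q≈1 below verifies that it is the inverse of Q.  With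
  -- u = Q(0)⁻¹ it is the geometric series Σₖ u (1 - u Q)ᵏ; as 1 - u Q has no
  -- constant term, only the k ≤ |α| contribute to the coefficient at α.
  module _ {m} (Q : Series m) (Q₀#0 : coeff 𝟎 Q # 0#) where

    Q₀⁻¹ : Carrier
    Q₀⁻¹ = proj₁ (#⇒invertible Q₀#0)

    remainder : Series m
    remainder α = coeff α Ser.1# - Q₀⁻¹ * Q α

    1/_⟨_⟩ : Series m
    1/_⟨_⟩ α =
      sum {suc (Vec.sum α)} (λ k → Q₀⁻¹ * coeff α (remainder Ser.^ toℕ k))

  open import Relation.Binary.Reasoning.Setoid setoid
  open import Algebra.Apartness.Properties.HeytingCommutativeRing
    heytingCommutativeRing using (x-0≈x; 1#0; #-congʳ)
  open import Algebra.Properties.CommutativeMonoid.Sum +-commutativeMonoid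
    using (sum-cong-≋; sum-replicate-zero; ∑-comm)
  open import Algebra.Properties.Semiring.Sum semiring using (*-distribˡ-sum)
  open import Algebra.Properties.Ring ring
    using (-‿distribˡ-*; -‿anti-homo-+; -‿involutive)
  open import Algebra.Properties.AbelianGroup +-abelianGroup using (⁻¹-∙-comm)
  open import Algebra.Properties.CommutativeSemigroup +-commutativeSemigroup
    using (interchange)
  open import Algebra.Properties.CommutativeSemigroup ℕ.+-commutativeSemigroup
    using () renaming (interchange to ℕ-interchange)

  sum-zero : ∀ {n} (f : Fin n → Carrier) → (∀ i → f i ≈ 0#) → sum f ≈ 0#
  sum-zero {n} f h = trans (sum-cong-≋ h) (sum-replicate-zero n)

  ∑-cong : ∀ {m} (α : Vec ℕ m) {F G : Vec ℕ m → Vec ℕ m → Carrier} →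
           (∀ β γ → zipWith ℕ._+_ β γ ≡ α → F β γ ≈ G β γ) →
           ∑⟨ α ⟩ F ≈ ∑⟨ α ⟩ G
  ∑-cong []      h = h [] [] ≡.refl
  ∑-cong (a ∷ α) {F} {G} h =
    sum-cong-≋ {x = λ i → ∑⟨ α ⟩ (slice F a i)} {λ i → ∑⟨ α ⟩ (slice G a i)}
      λ i → ∑-cong α λ β γ e →
        h (toℕ i ∷ β) (a ℕ.∸ toℕ i ∷ γ)
          (≡.cong₂ _∷_ (ℕ.m+[n∸m]≡n (toℕ≤pred[n] i)) e)

  ∑-zero : ∀ {m} (α : Vec ℕ m) (F : Vec ℕ m → Vec ℕ m → Carrier) →
           (∀ β γ → zipWith ℕ._+_ β γ ≡ α → F β γ ≈ 0#) → ∑⟨ α ⟩ F ≈ 0#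
  ∑-zero α F h = trans (∑-cong α h) (go α)
    where
    go : ∀ {m} (α : Vec ℕ m) → ∑⟨ α ⟩ (λ _ _ → 0#) ≈ 0#
    go []      = refl
    go (a ∷ α) = sum-zero {suc a} (λ _ → ∑⟨ α ⟩ (λ _ _ → 0#)) (λ _ → go α)

  ∑-sum : ∀ {m n} (α : Vec ℕ m) (F : Fin n → Vec ℕ m → Vec ℕ m → Carrier) →
          ∑⟨ α ⟩ (λ β γ → sum (λ k → F k β γ)) ≈ sum (λ k → ∑⟨ α ⟩ (F k))
  ∑-sum []      F = refl
  ∑-sum (a ∷ α) F = trans
    (sum-cong-≋ {x = λ i → ∑⟨ α ⟩ (λ β γ → sum (λ k → slice (F k) a i β γ))}
                {λ i → sum (λ k → ∑⟨ α ⟩ (slice (F k) a i))}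
                (λ i → ∑-sum α (λ k → slice (F k) a i)))
    (∑-comm (λ i k → ∑⟨ α ⟩ (slice (F k) a i)))

  ∑-𝟎 : ∀ m (F : Vec ℕ m → Vec ℕ m → Carrier) → ∑⟨ 𝟎 ⟩ F ≈ F 𝟎 𝟎
  ∑-𝟎 zero    F = refl
  ∑-𝟎 (suc m) F = trans (+-identityʳ _) (∑-𝟎 m _)

  1*f≈f : ∀ {m} (f : Series m) α → ∑⟨ α ⟩ (λ β γ → monomial 𝟎 β * f γ) ≈ f α
  1*f≈f f []      = *-identityˡ _
  1*f≈f f (a ∷ α) = begin
    _          ≈⟨ +-cong (1*f≈f (f ∘ (a ∷_)) α)
                         (sum-zero {a} _ λ i → ∑-zero α _ λ _ _ _ → zeroˡ _) ⟩
    f (a ∷ α) + 0# ≈⟨ +-identityʳ _ ⟩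
    f (a ∷ α)      ∎

  1₀≈1 : ∀ m → coeff 𝟎 (monomial {m} 𝟎) ≈ 1#
  1₀≈1 zero    = refl
  1₀≈1 (suc m) = 1₀≈1 m

  weight-+ : ∀ {m} (β γ : Vec ℕ m) →
             Vec.sum (zipWith ℕ._+_ β γ) ≡ Vec.sum β ℕ.+ Vec.sum γ
  weight-+ []      []      = ≡.refl
  weight-+ (b ∷ β) (d ∷ γ) rewrite weight-+ β γ =
    ℕ-interchange b d (Vec.sum β) (Vec.sum γ)

  weight-0 : ∀ {m} (β : Vec ℕ m) → Vec.sum β ≡ 0 → β ≡ 𝟎
  weight-0 []         e = ≡.refl
  weight-0 (zero ∷ β) e = ≡.cong (0 ∷_) (weight-0 β e)

  power-vanishes : ∀ {m} (D : Series m) → D 𝟎 ≈ 0# →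
                   ∀ k β → Vec.sum β < k → (D Ser.^ k) β ≈ 0#
  power-vanishes D D₀ (suc k) α (s≤s α≤k) = ∑-zero α _ term
    where
    term : ∀ β γ → zipWith ℕ._+_ β γ ≡ α → D β * (D Ser.^ k) γ ≈ 0#
    term β γ ≡.refl with Vec.sum β in eq
    ... | zero  = trans (*-congʳ (trans (reflexive (≡.cong D (weight-0 β eq))) D₀)) (zeroˡ _)
    ... | suc b = trans (*-congˡ (power-vanishes D D₀ k γ γ<k)) (zeroʳ _)
      where
      γ<k : Vec.sum γ < k
      γ<k = ℕ.≤-trans (s≤s (ℕ.m≤n+m (Vec.sum γ) b))
        (≡.subst (_≤ k) (≡.trans (weight-+ β γ) (≡.cong (ℕ._+ Vec.sum γ) eq)) α≤k)

  sum-extend : ∀ {n N} → n ≤ N → (g : ℕ → Carrier) → (∀ k → n ≤ k → g k ≈ 0#) →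
               sum {n} (λ k → g (toℕ k)) ≈ sum {N} (λ k → g (toℕ k))
  sum-extend {N = N} z≤n g h =
    sym (sum-zero {N} (λ k → g (toℕ k)) (λ k → h (toℕ k) z≤n))
  sum-extend (s≤s p) g h = +-congˡ (sum-extend p (g ∘ suc) (λ k q → h (suc k) (s≤s q)))

  telescope : ∀ n (g : ℕ → Carrier) →
              sum {n} (λ k → g (toℕ k) - g (suc (toℕ k))) ≈ g 0 - g n
  telescope zero    g = sym (-‿inverseʳ _)
  telescope (suc n) g = begin
    (g 0 - g 1) + _                 ≈⟨ +-congˡ (telescope n (g ∘ suc)) ⟩
    (g 0 - g 1) + (g 1 - g (suc n)) ≈⟨ +-assoc _ _ _ ⟩
    g 0 + (- g 1 + (g 1 - g (suc n))) ≈⟨ +-congˡ (+-assoc _ _ _) ⟨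
    g 0 + ((- g 1 + g 1) - g (suc n)) ≈⟨ +-congˡ (+-congʳ (-‿inverseˡ _)) ⟩
    g 0 + (0# - g (suc n))          ≈⟨ +-congˡ (+-identityˡ _) ⟩
    g 0 - g (suc n) ∎

  x-[x-y]≈y : ∀ x y → x - (x - y) ≈ y
  x-[x-y]≈y x y = begin
    x - (x - y)     ≈⟨ +-congˡ (⁻¹-anti x y) ⟩
    x + (y - x)     ≈⟨ +-comm _ _ ⟩
    (y - x) + x     ≈⟨ +-assoc _ _ _ ⟩
    y + (- x + x)   ≈⟨ +-congˡ (-‿inverseˡ x) ⟩
    y + 0#          ≈⟨ +-identityʳ y ⟩
    y               ∎
    where
    ⁻¹-anti : ∀ x y → - (x - y) ≈ y - x
    ⁻¹-anti x y = trans (-‿anti-homo-+ x (- y)) (+-congʳ (-‿involutive y))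

  Q*1/Q≈1 : ∀ {m} (Q : Series m) (p : coeff 𝟎 Q # 0#) → (Q Ser.* 1/ Q ⟨ p ⟩) Ser.≈ Ser.1#
  Q*1/Q≈1 {m} Q p α = begin
    ∑⟨ α ⟩ (λ β γ → Q β * 1/ Q ⟨ p ⟩ γ)
      ≈⟨ ∑-cong α (λ β γ e → trans (*-congˡ (extend β γ e))
            (*-distribˡ-sum {suc N} (Q β) (λ k → u * (D Ser.^ toℕ k) γ))) ⟩
    ∑⟨ α ⟩ (λ β γ → sum {suc N} (λ k → Q β * (u * (D Ser.^ toℕ k) γ)))
      ≈⟨ ∑-sum {n = suc N} α (λ k β γ → Q β * (u * (D Ser.^ toℕ k) γ)) ⟩
    sum {suc N} (λ k → ∑⟨ α ⟩ (λ β γ → Q β * (u * (D Ser.^ toℕ k) γ)))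
      ≈⟨ sum-cong-≋ {x = λ k → ∑⟨ α ⟩ (λ β γ → Q β * (u * (D Ser.^ toℕ k) γ))}
                     {λ k → (D Ser.^ toℕ k) α - (D Ser.^ suc (toℕ k)) α}
                     (λ (k : Fin (suc N)) → step (toℕ k)) ⟩
    sum {suc N} (λ k → (D Ser.^ toℕ k) α - (D Ser.^ suc (toℕ k)) α)
      ≈⟨ telescope (suc N) (λ k → (D Ser.^ k) α) ⟩
    coeff α Ser.1# - (D Ser.^ suc N) α
      ≈⟨ +-congˡ (-‿cong (power-vanishes D D₀≈0 (suc N) α ℕ.≤-refl)) ⟩
    coeff α Ser.1# - 0#
      ≈⟨ x-0≈x _ ⟩
    coeff α Ser.1# ∎
    where
    N = Vec.sum α
    u = Q₀⁻¹ Q p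
    D = remainder Q p

    D₀≈0 : D 𝟎 ≈ 0#
    D₀≈0 = begin
      coeff (𝟎 {m}) Ser.1# - u * Q 𝟎 ≈⟨ +-cong (1₀≈1 m) (-‿cong (begin
        u * Q 𝟎         ≈⟨ *-congˡ (x-0≈x _) ⟨
        u * (Q 𝟎 - 0#)  ≈⟨ proj₁ (proj₂ (#⇒invertible p)) ⟩
        1#              ∎)) ⟩
      1# - 1#            ≈⟨ -‿inverseʳ 1# ⟩
      0#                 ∎

    extend : ∀ β γ → zipWith ℕ._+_ β γ ≡ α →
             1/ Q ⟨ p ⟩ γ ≈ sum {suc N} (λ k → u * (D Ser.^ toℕ k) γ)
    extend β γ ≡.refl = sum-extend
      (s≤s (≡.subst (Vec.sum γ ≤_) (≡.sym (weight-+ β γ)) (ℕ.m≤n+m _ _)))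
      (λ k → u * (D Ser.^ k) γ)
      (λ k q → trans (*-congˡ (power-vanishes D D₀≈0 k γ q)) (zeroʳ _))

    ∑-sub : ∀ {m} (α : Vec ℕ m) (F G : Vec ℕ m → Vec ℕ m → Carrier) →
            ∑⟨ α ⟩ (λ β γ → F β γ - G β γ) ≈ ∑⟨ α ⟩ F - ∑⟨ α ⟩ G
    ∑-sub []      F G = refl
    ∑-sub (a ∷ α) F G = trans
      (sum-cong-≋ {x = λ i → ∑⟨ α ⟩ (λ β γ → slice F a i β γ - slice G a i β γ)}
                  {λ i → ∑⟨ α ⟩ (slice F a i) - ∑⟨ α ⟩ (slice G a i)}
                  (λ i → ∑-sub α (slice F a i) (slice G a i)))
      (sum-sub (λ i → ∑⟨ α ⟩ (slice F a i)) (λ i → ∑⟨ α ⟩ (slice G a i)))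
      where
      sum-sub : ∀ {n} (f g : Fin n → Carrier) → sum (λ i → f i - g i) ≈ sum f - sum g
      sum-sub {zero}  f g = sym (-‿inverseʳ 0#)
      sum-sub {suc n} f g = begin
        (f 0F - g 0F) + _                          ≈⟨ +-congˡ (sum-sub (f ∘ Fin.suc) (g ∘ Fin.suc)) ⟩
        (f 0F - g 0F) + (sum (f ∘ Fin.suc) - sum (g ∘ Fin.suc)) ≈⟨ interchange _ _ _ _ ⟩
        _                                          ≈⟨ +-congˡ (⁻¹-∙-comm _ _) ⟩
        sum f - sum g                              ∎

    step : ∀ k → ∑⟨ α ⟩ (λ β γ → Q β * (u * (D Ser.^ k) γ)) ≈
                 (D Ser.^ k) α - (D Ser.^ suc k) α
    step k = begin
      ∑⟨ α ⟩ (λ β γ → Q β * (u * (D Ser.^ k) γ))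
        ≈⟨ ∑-cong α (λ β γ _ → begin
             Q β * (u * (D Ser.^ k) γ)           ≈⟨ *-assoc _ _ _ ⟨
             (Q β * u) * (D Ser.^ k) γ           ≈⟨ *-congʳ (*-comm _ _) ⟩
             (u * Q β) * (D Ser.^ k) γ           ≈⟨ *-congʳ (x-[x-y]≈y _ _) ⟨
             (Ser.1# β - D β) * (D Ser.^ k) γ    ≈⟨ distribʳ _ _ _ ⟩
             Ser.1# β * (D Ser.^ k) γ + - D β * (D Ser.^ k) γ
                                                 ≈⟨ +-congˡ (-‿distribˡ-* _ _) ⟨
             Ser.1# β * (D Ser.^ k) γ - D β * (D Ser.^ k) γ ∎) ⟩
      ∑⟨ α ⟩ (λ β γ → Ser.1# β * (D Ser.^ k) γ - D β * (D Ser.^ k) γ)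
        ≈⟨ ∑-sub α _ _ ⟩
      ∑⟨ α ⟩ (λ β γ → Ser.1# β * (D Ser.^ k) γ) - (D Ser.^ suc k) α
        ≈⟨ +-congʳ (1*f≈f (D Ser.^ k) α) ⟩
      (D Ser.^ k) α - (D Ser.^ suc k) α ∎

  coeff-sum : ∀ {m n} (f : Fin n → Series m) α → Ser.sum f α ≈ sum (λ i → f i α)
  coeff-sum {n = zero}  f α = refl
  coeff-sum {n = suc n} f α = +-congˡ (coeff-sum (f ∘ Fin.suc) α)

  *-coeff₀ : ∀ {m} (f g : Series m) → (f Ser.* g) 𝟎 ≈ f 𝟎 * g 𝟎
  *-coeff₀ {m} f g = ∑-𝟎 m _

  module _ {m : ℕ} where
    open Matrices (seriesRawRing m)

    det-coeff₀ : ∀ n (A : Matrix n) →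
                 (∀ i j → A i j 𝟎 ≈ (if does (i Fin.≟ j) then 1# else 0#)) →
                 det A 𝟎 ≈ 1#
    det-coeff₀ zero    A h = 1₀≈1 m
    det-coeff₀ (suc n) A h = begin
      det A 𝟎       ≈⟨ coeff-sum (λ j → S j) 𝟎 ⟩
      S 0F 𝟎 + sum (λ j → S (Fin.suc j) 𝟎)
        ≈⟨ +-cong head (sum-zero {n} _ tail) ⟩
      1# + 0#       ≈⟨ +-identityʳ 1# ⟩
      1#            ∎
      where
      minor : Fin (suc n) → Matrix n
      minor j i k = A (Fin.suc i) (punchIn j k)

      S : Fin (suc n) → Series m
      S j = (Ser.- Ser.1#) Ser.^ toℕ j Ser.* (A 0F j Ser.* det (minor j))

      head : S 0F 𝟎 ≈ 1#
      head = begin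
        S 0F 𝟎                          ≈⟨ 1*f≈f (A 0F 0F Ser.* det (minor 0F)) 𝟎 ⟩
        (A 0F 0F Ser.* det (minor 0F)) 𝟎 ≈⟨ *-coeff₀ (A 0F 0F) (det (minor 0F)) ⟩
        A 0F 0F 𝟎 * det (minor 0F) 𝟎
          ≈⟨ *-cong (h 0F 0F) (det-coeff₀ n (minor 0F) (λ i j → h (Fin.suc i) (Fin.suc j))) ⟩
        1# * 1#                         ≈⟨ *-identityˡ 1# ⟩
        1#                              ∎

      tail : ∀ j → S (Fin.suc j) 𝟎 ≈ 0#
      tail j = begin
        S j′ 𝟎                                       ≈⟨ *-coeff₀ (ε Ser.^ toℕ j′) (A 0F j′ Ser.* det (minor j′)) ⟩
        (ε Ser.^ toℕ j′) 𝟎 * (A 0F j′ Ser.* det (minor j′)) 𝟎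
          ≈⟨ *-congˡ (*-coeff₀ (A 0F j′) (det (minor j′))) ⟩
        (ε Ser.^ toℕ j′) 𝟎 * (A 0F j′ 𝟎 * det (minor j′) 𝟎)
          ≈⟨ *-congˡ (trans (*-congʳ (h 0F j′)) (zeroˡ _)) ⟩
        (ε Ser.^ toℕ j′) 𝟎 * 0#                      ≈⟨ zeroʳ _ ⟩
        0#                                           ∎
        where
        j′ = Fin.suc j
        ε  = Ser.- Ser.1#

  module _ where
    open Ser {4}
      using () renaming (_+_ to _⊞_; _*_ to _⊠_; -_ to ⊟_; _×_ to _·_; 1# to 𝟏)
    open Matrices (seriesRawRing 4)

    infixl 6 _⊟_
    _⊟_ : Series 4 → Series 4 → Series 4
    f ⊟ g = f ⊞ (⊟ g)

    x y z t : Series 4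
    x = var 0F
    y = var 1F
    z = var 2F
    t = var 3F

    Q₁ : Series 4
    Q₁ = 𝟏 ⊟ (x ⊞ y) ⊠ (𝟏 ⊟ 4 · (z ⊠ t)) ⊟ z ⊟ t

    Q₂ : Series 4
    Q₂ = det (identity ⊖ diag (lookup (x ∷ y ∷ z ∷ t ∷ [])) ⊗ M)

    ≈1⇒#0 : ∀ {a} → a ≈ 1# → a # 0#
    ≈1⇒#0 e = #-congʳ (sym e) 1#0

    a-b≈a : ∀ {a b} → b ≈ 0# → a - b ≈ a
    a-b≈a {a} e = trans (+-congˡ (-‿cong e)) (x-0≈x a)

    Q₁#0 : coeff 𝟎 Q₁ # 0#
    Q₁#0 = ≈1⇒#0 (trans (a-b≈a refl) (trans (a-b≈a refl) (a-b≈a (begin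
      ((x ⊞ y) ⊠ w) 𝟎      ≈⟨ *-coeff₀ (x ⊞ y) w ⟩
      (0# + 0#) * w 𝟎      ≈⟨ *-congʳ (+-identityˡ 0#) ⟩
      0# * w 𝟎             ≈⟨ zeroˡ _ ⟩
      0#                   ∎))))
      where w = 𝟏 ⊟ 4 · (z ⊠ t)

    Q₂#0 : coeff 𝟎 Q₂ # 0#
    Q₂#0 = ≈1⇒#0 (det-coeff₀ 4 (identity ⊖ diag X ⊗ M) λ i j → trans (a-b≈a (entry i j)) (δ i j))
      where
      X = lookup (x ∷ y ∷ z ∷ t ∷ [])

      X₀ : ∀ i → X i 𝟎 ≈ 0#
      X₀ 0F = refl
      X₀ 1F = refl
      X₀ 2F = refl
      X₀ 3F = refl

      diag₀ : ∀ i j → diag X i j 𝟎 ≈ 0#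
      diag₀ i j with does (i Fin.≟ j)
      ... | true  = X₀ i
      ... | false = refl

      δ : ∀ i j → identity {4} i j 𝟎 ≈ (if does (i Fin.≟ j) then 1# else 0#)
      δ i j with does (i Fin.≟ j)
      ... | true  = refl
      ... | false = refl

      entry : ∀ i j → (diag X ⊗ M) i j 𝟎 ≈ 0#
      entry i j = trans (coeff-sum (λ k → diag X i k ⊠ M k j) 𝟎)
        (sum-zero (λ k → (diag X i k ⊠ M k j) 𝟎) λ k →
        trans (*-coeff₀ (diag X i k) (M k j)) (trans (*-congʳ (diag₀ i k)) (zeroˡ _)))

{-# OPTIONS --safe #-}
module Submission where

-- Write s = x + y.  Expanding the determinant gives 1 - s (1 - 4zt) - z - t, so
-- the two denominators are equal, and the second equality is the uniqueness of
-- inverses in the commutative ring of formal power series (seriesRing,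
-- inverse-unique, det[I-XM]).
--
-- For the first equality, order the common denominator by powers of z: it is
-- V - z W with V = 1 - s - t and W = 1 - 4st, hence its inverse is the sum over
-- p of z^p W^p / V^(p+1) (Q₀*G≈1).  Replacing s by x + y multiplies the
-- coefficient of s^(a+b) by the binomial coefficient C(a+b, a) when it moves to
-- x^a y^b (Q₁*σ).  The coefficient of (xyzt)^n is therefore C(2n, n) times that
-- of s^(2n) t^n in W^n / V^(n+1).
--
-- Along a diagonal s^(j+p) t^j, multiplication by W acts as the operator
-- Δ f j = f (j+1) - 4 f j (W^-diagonal).  The coefficient of s^(j+p) t^j in
-- 1 / V^(p+1) is T p j = (2j+2p)! / (p! (j+p)! j!), and these numbers satisfy
--     p Δ (T p) j = (4p - 2) T (p-1) (j+1)   (ΔT),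
-- so that n applications of Δ turn T n into a multiple of T 0 and
--     Δ^n (T n) 0 = C(2n, n) T 0 n = C(2n, n)²   (Δ^T).
-- The cancellation of p is done in ℤ, since the image of p in the field may be
-- zero; the result is then mapped along the ring homomorphism fromℤ.

open import Defs
open import Algebra.Apartness.Bundles using (HeytingField; HeytingCommutativeRing)
open import Algebra.Bundles using (RawRing; Semiring; CommutativeRing)
import Algebra.Properties.CommutativeSemigroup as CommutativeSemigroupProperties
import Algebra.Properties.Ring as RingProperties
import Algebra.Properties.Semiring.Mult.TCOptimised as Multiples
import Algebra.Solver.Ring
open import Algebra.Solver.Ring.AlmostCommutativeRing
  using (fromCommutativeRing; _-Raw-AlmostCommutative⟶_)
open import Algebra.Structures using (IsAbelianGroup)
open import Data.Fin.Base using (Fin; toℕ)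
open import Data.Fin.Patterns using (0F; 1F; 2F; 3F)
open import Data.Integer.Base as ℤ using (ℤ; +_; -[1+_])
import Data.Integer.Properties as ℤ
import Data.Integer.Tactic.RingSolver as ℤ-Solver
import Data.Maybe.Base as Maybe
open import Data.Nat.Base as ℕ using (ℕ; zero; suc)
open import Data.Nat.Combinatorics using (_C_; nCn≡1; nCk+nC[k+1]≡[n+1]C[k+1])
import Data.Nat.Properties as ℕ
import Data.Nat.Tactic.RingSolver as ℕ-Solver
open import Data.Product.Base as Product using (_,_)
open import Data.Vec.Base using (Vec; []; _∷_; lookup)
open import Function.Base using (flip; _∘_)
import Relation.Binary.Reasoning.Setoid as SetoidReasoning
open import Relation.Binary.PropositionalEquality as ≡ using (_≡_; cong; cong₂)
open import Relation.Nullary.Decidable using (dec⇒maybe)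

-- Integers in a commutative ring

module IntegerMultiples {c ℓ} (R : CommutativeRing c ℓ) where
  open CommutativeRing R
  open RingProperties ring
    using (-0#≈0#; -‿distribˡ-*; -‿distribʳ-*; -‿involutive; -‿+-comm)
  open Multiples semiring using (_×_; 1+×; ×-homo-+; ×1-homo-*)
  open CommutativeSemigroupProperties +-commutativeSemigroup using (interchange)
  open SetoidReasoning setoid

  -- The unique ring homomorphism from ℤ.  Multiples are taken in the form in
  -- which 1 × x computes to x, so that the constants 0 and 1 of the solver below
  -- evaluate to 0# and 1# by computation.
  fromℤ : ℤ → Carrier
  fromℤ (+ n)    = n × 1#
  fromℤ -[1+ n ] = - (suc n × 1#)

  fromℤ-⊖ : ∀ m n → fromℤ (m ℤ.⊖ n) ≈ m × 1# - n × 1#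
  fromℤ-⊖ m       zero    = sym (trans (+-congˡ -0#≈0#) (+-identityʳ _))
  fromℤ-⊖ zero    (suc n) = sym (+-identityˡ _)
  fromℤ-⊖ (suc m) (suc n) = begin
    fromℤ (suc m ℤ.⊖ suc n)               ≡⟨ cong fromℤ (ℤ.[1+m]⊖[1+n]≡m⊖n m n) ⟩
    fromℤ (m ℤ.⊖ n)                       ≈⟨ fromℤ-⊖ m n ⟩
    m × 1# - n × 1#                       ≈⟨ +-identityˡ _ ⟨
    0# + (m × 1# - n × 1#)                ≈⟨ +-congʳ (-‿inverseʳ 1#) ⟨
    (1# - 1#) + (m × 1# - n × 1#)         ≈⟨ interchange _ _ _ _ ⟩
    (1# + m × 1#) + (- 1# + - (n × 1#))   ≈⟨ +-cong (sym (1+× m 1#)) (-‿+-comm 1# (n × 1#)) ⟩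
    suc m × 1# - (1# + n × 1#)            ≈⟨ +-congˡ (-‿cong (1+× n 1#)) ⟨
    suc m × 1# - suc n × 1#               ∎

  fromℤ-neg : ∀ i → fromℤ (ℤ.- i) ≈ - fromℤ i
  fromℤ-neg (+ zero)  = sym -0#≈0#
  fromℤ-neg (+ suc n) = refl
  fromℤ-neg -[1+ n ]  = sym (-‿involutive _)

  fromℤ-+ : ∀ i j → fromℤ (i ℤ.+ j) ≈ fromℤ i + fromℤ j
  fromℤ-+ (+ m)    (+ n)    = ×-homo-+ 1# m n
  fromℤ-+ (+ m)    -[1+ n ] = fromℤ-⊖ m (suc n)
  fromℤ-+ -[1+ m ] (+ n)    = trans (fromℤ-⊖ n (suc m)) (+-comm _ _)
  fromℤ-+ -[1+ m ] -[1+ n ] = begin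
    - (suc (suc (m ℕ.+ n)) × 1#)          ≡⟨ cong (λ k → - (k × 1#)) (ℕ.+-suc (suc m) n) ⟨
    - ((suc m ℕ.+ suc n) × 1#)            ≈⟨ -‿cong (×-homo-+ 1# (suc m) (suc n)) ⟩
    - (suc m × 1# + suc n × 1#)           ≈⟨ -‿+-comm _ _ ⟨
    - (suc m × 1#) + - (suc n × 1#)       ∎

  fromℤ-*⁺ : ∀ m j → fromℤ (+ m ℤ.* j) ≈ fromℤ (+ m) * fromℤ j
  fromℤ-*⁺ m (+ n)    = trans (reflexive (cong fromℤ (≡.sym (ℤ.pos-* m n)))) (×1-homo-* m n)
  fromℤ-*⁺ m -[1+ n ] = begin
    fromℤ (+ m ℤ.* (ℤ.- + suc n))         ≡⟨ cong fromℤ (ℤ.neg-distribʳ-* (+ m) (+ suc n)) ⟨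
    fromℤ (ℤ.- (+ m ℤ.* + suc n))         ≈⟨ fromℤ-neg (+ m ℤ.* + suc n) ⟩
    - fromℤ (+ m ℤ.* + suc n)             ≈⟨ -‿cong (fromℤ-*⁺ m (+ suc n)) ⟩
    - (m × 1# * suc n × 1#)               ≈⟨ -‿distribʳ-* _ _ ⟩
    m × 1# * - (suc n × 1#)               ∎

  fromℤ-* : ∀ i j → fromℤ (i ℤ.* j) ≈ fromℤ i * fromℤ j
  fromℤ-* (+ m)    j = fromℤ-*⁺ m j
  fromℤ-* -[1+ m ] j = begin
    fromℤ ((ℤ.- + suc m) ℤ.* j)           ≡⟨ cong fromℤ (ℤ.neg-distribˡ-* (+ suc m) j) ⟨
    fromℤ (ℤ.- (+ suc m ℤ.* j))           ≈⟨ fromℤ-neg (+ suc m ℤ.* j) ⟩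
    - fromℤ (+ suc m ℤ.* j)               ≈⟨ -‿cong (fromℤ-*⁺ (suc m) j) ⟩
    - (suc m × 1# * fromℤ j)              ≈⟨ -‿distribˡ-* _ _ ⟩
    - (suc m × 1#) * fromℤ j              ∎

  homomorphism : ℤ.+-*-rawRing -Raw-AlmostCommutative⟶ fromCommutativeRing R
  homomorphism = record
    { ⟦_⟧    = fromℤ
    ; +-homo = fromℤ-+
    ; *-homo = fromℤ-*
    ; -‿homo = fromℤ-neg
    ; 0-homo = refl
    ; 1-homo = refl
    }

  -- A solver for ring identities over R with integer coefficients.
  module Solver = Algebra.Solver.Ring ℤ.+-*-rawRing (fromCommutativeRing R) homomorphism
    (λ i j → Maybe.map (λ eq → reflexive (cong fromℤ eq)) (dec⇒maybe (i ℤ.≟ j)))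

-- The determinant

module Determinant {c ℓ} (R : CommutativeRing c ℓ) where
  open CommutativeRing R
  open IntegerMultiples.Solver R
  open Matrices rawRing
  open import Algebra.Definitions.RawSemiring (RawRing.rawSemiring rawRing) using (_×_)

  -- Syntactic polynomials in four indeterminates.  Matrices over them evaluate,
  -- by computation, to the matrices over R.
  polynomialRing : RawRing _ _
  polynomialRing = record
    { Carrier = Polynomial 4
    ; _≈_ = _≡_
    ; _+_ = _:+_
    ; _*_ = _:*_
    ; -_  = :-_
    ; 0#  = con ℤ.0ℤ
    ; 1#  = con ℤ.1ℤ
    }
  private module P = Matrices polynomialRing

  det[I-XM] : ∀ x y z t →
    1# - (x + y) * (1# - 4 × (z * t)) - z - t ≈
    det (identity ⊖ diag (lookup (x ∷ y ∷ z ∷ t ∷ [])) ⊗ M)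
  det[I-XM] = solve 4 (λ x y z t →
    con ℤ.1ℤ :- (x :+ y) :* (con ℤ.1ℤ :- 4 :× (z :* t)) :- z :- t :=
    P.det (P.identity P.⊖ P.diag (lookup (x ∷ y ∷ z ∷ t ∷ [])) P.⊗ P.M)) refl

-- Binomial and trinomial coefficients

module _ where
  open import Data.Nat.Base using (_+_; _*_)
  open ≡ using (refl; sym; trans)
  open ≡.≡-Reasoning

  -- binom a b is the binomial coefficient of a + b over a, defined by Pascal's
  -- rule so that the rule holds by computation.
  binom : ℕ → ℕ → ℕ
  binom zero    b       = 1
  binom (suc a) zero    = 1
  binom (suc a) (suc b) = binom a (suc b) + binom (suc a) b

  binom-zeroʳ : ∀ a → binom a 0 ≡ 1
  binom-zeroʳ zero    = refl
  binom-zeroʳ (suc a) = refl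

  binom≡C : ∀ a b → binom a b ≡ (a + b) C a
  binom≡C zero    b       = refl
  binom≡C (suc a) zero    rewrite ℕ.+-identityʳ a = sym (nCn≡1 (suc a))
  binom≡C (suc a) (suc b) = begin
    binom a (suc b) + binom (suc a) b          ≡⟨ cong₂ _+_ (binom≡C a (suc b)) (binom≡C (suc a) b) ⟩
    (a + suc b) C a + (suc a + b) C suc a      ≡⟨ cong (λ n → (a + suc b) C a + n C suc a) (ℕ.+-suc a b) ⟨
    (a + suc b) C a + (a + suc b) C suc a      ≡⟨ nCk+nC[k+1]≡[n+1]C[k+1] (a + suc b) a ⟩
    (suc a + suc b) C suc a                    ∎

  binom-sucˡ : ∀ a b → suc a * binom (suc a) b ≡ suc (a + b) * binom a b
  binom-sucʳ : ∀ a b → suc b * binom a (suc b) ≡ suc (a + b) * binom a b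

  binom-sucˡ a zero    rewrite ℕ.+-identityʳ a | binom-zeroʳ a = refl
  binom-sucˡ a (suc b) = begin
    suc a * (binom a (suc b) + binom (suc a) b)
      ≡⟨ ℕ.*-distribˡ-+ (suc a) (binom a (suc b)) _ ⟩
    suc a * binom a (suc b) + suc a * binom (suc a) b
      ≡⟨ cong (λ k → suc a * binom a (suc b) + k) (trans (binom-sucˡ a b) (sym (binom-sucʳ a b))) ⟩
    suc a * binom a (suc b) + suc b * binom a (suc b)
      ≡⟨ ℕ.*-distribʳ-+ (binom a (suc b)) (suc a) (suc b) ⟨
    suc (a + suc b) * binom a (suc b) ∎

  binom-sucʳ zero    b = refl
  binom-sucʳ (suc a) b = begin
    suc b * (binom a (suc b) + binom (suc a) b)
      ≡⟨ ℕ.*-distribˡ-+ (suc b) (binom a (suc b)) _ ⟩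
    suc b * binom a (suc b) + suc b * binom (suc a) b
      ≡⟨ cong (λ k → k + suc b * binom (suc a) b) (trans (binom-sucʳ a b) (sym (binom-sucˡ a b))) ⟩
    suc a * binom (suc a) b + suc b * binom (suc a) b
      ≡⟨ ℕ.*-distribʳ-+ (binom (suc a) b) (suc a) (suc b) ⟨
    (suc a + suc b) * binom (suc a) b
      ≡⟨ cong (λ n → suc n * binom (suc a) b) (ℕ.+-suc a b) ⟩
    suc (suc a + b) * binom (suc a) b ∎

  central-suc : ∀ q → suc q * binom (suc q) (suc q) ≡ (4 * q + 2) * binom q q
  central-suc q = begin
    suc q * binom (suc q) (suc q)                 ≡⟨ binom-sucˡ q (suc q) ⟩
    suc (q + suc q) * binom q (suc q)             ≡⟨ lemma q (binom q (suc q)) ⟩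
    2 * (suc q * binom q (suc q))                 ≡⟨ cong (λ k → 2 * k) (binom-sucʳ q q) ⟩
    2 * (suc (q + q) * binom q q)                 ≡⟨ lemma′ q (binom q q) ⟩
    (4 * q + 2) * binom q q                       ∎
    where
    lemma : ∀ q b → suc (q + suc q) * b ≡ 2 * (suc q * b)
    lemma = ℕ-Solver.solve-∀
    lemma′ : ∀ q b → 2 * (suc (q + q) * b) ≡ (4 * q + 2) * b
    lemma′ = ℕ-Solver.solve-∀

  -- The trinomial coefficient (p + m + d)! / (p! m! d!).  As a function of m and
  -- d it lists the coefficients of s^m t^d in 1 / (1 - s - t)^(p+1).
  trinom : ℕ → ℕ → ℕ → ℕ
  trinom p m d = binom p (m + d) * binom m d

  -- Multiplication by s and by t, on tables of coefficients of s^m t^d.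
  shiftˡ shiftʳ : (ℕ → ℕ → ℕ) → ℕ → ℕ → ℕ
  shiftˡ f zero    d = 0
  shiftˡ f (suc m) d = f m d
  shiftʳ f m zero    = 0
  shiftʳ f m (suc d) = f m d

  -- The coefficients of 1 / V^(p+2) times V = 1 - s - t are those of 1 / V^(p+1).
  trinom-pascal : ∀ p m d → let f = trinom (suc p) in
    f m d ≡ trinom p m d + shiftˡ f m d + shiftʳ f m d
  trinom-pascal p zero    zero    rewrite binom-zeroʳ p = refl
  trinom-pascal p zero    (suc d) = l (binom p (suc d)) (binom (suc p) d)
    where
    l : ∀ a b → (a + b) * 1 ≡ a * 1 + 0 + b * 1
    l = ℕ-Solver.solve-∀
  trinom-pascal p (suc m) zero    rewrite binom-zeroʳ m =
    l (binom p (suc m + 0)) (binom (suc p) (m + 0))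
    where
    l : ∀ a b → (a + b) * 1 ≡ a * 1 + b * 1 + 0
    l = ℕ-Solver.solve-∀
  trinom-pascal p (suc m) (suc d) rewrite ℕ.+-suc m d =
    l (binom p (suc (suc (m + d)))) (binom (suc p) (suc (m + d))) (binom m (suc d)) (binom (suc m) d)
    where
    l : ∀ a b c d → (a + b) * (c + d) ≡ a * (c + d) + b * c + b * d
    l = ℕ-Solver.solve-∀

  -- Every term is a multiple of X Y = trinom q (suc j + q) (suc j), by the
  -- relations between neighbouring binomial coefficients.  For the left-hand side
  -- this requires the factor suc u = q + j + 2, which is cancelled afterwards.
  trinom-step : ∀ q j →
    suc q * trinom (suc q) (suc j + suc q) (suc j) ≡
    (4 * q + 2) * trinom q (suc j + q) (suc j) + 4 * (suc q * trinom (suc q) (j + suc q) j)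
  trinom-step q j rewrite ℕ.+-suc j q | ℕ.+-suc (j + q) j = begin
    suc q * (L₁ * L₂)                              ≡⟨ ℕ.*-cancelˡ-≡ _ _ (suc u) (begin
      suc u * (suc q * (L₁ * L₂))                    ≡⟨ l₁ (suc u) (suc q) L₁ L₂ ⟩
      (suc q * L₁) * (suc u * L₂)                    ≡⟨ cong₂ _*_ (binom-sucˡ q (suc (suc v)))
                                                          (trans (binom-sucˡ u (suc j))
                                                                 (cong (λ k → suc k * Y) (ℕ.+-suc u j))) ⟩
      (suc (q + suc (suc v)) * Z) * (suc (suc v) * Y) ≡⟨ l₂ (suc (q + suc (suc v))) Z (suc (suc v)) Y ⟩
      suc (q + suc (suc v)) * (suc (suc v) * Z) * Y  ≡⟨ cong (λ k → suc (q + suc (suc v)) * k * Y) (binom-sucʳ q (suc v)) ⟩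
      suc (q + suc (suc v)) * (suc (q + suc v) * X) * Y ≡⟨ l₃ q j X Y ⟩
      suc u * ((4 * q + 2) * (X * Y) + 4 * (suc j * (X * Y))) ∎) ⟩
    (4 * q + 2) * (X * Y) + 4 * (suc j * (X * Y))  ≡⟨ cong (λ k → (4 * q + 2) * (X * Y) + 4 * k) (begin
      suc j * (X * Y)                                ≡⟨ l₄ (suc j) X Y ⟩
      X * (suc j * Y)                                ≡⟨ cong (X *_) (binom-sucʳ u j) ⟩
      X * (suc v * binom u j)                        ≡⟨ l₅ X (suc v) (binom u j) ⟩
      (suc v * X) * binom u j                        ≡⟨ cong (_* binom u j) (trans (binom-sucʳ q v) (sym (binom-sucˡ q v))) ⟩
      (suc q * binom (suc q) v) * binom u j          ≡⟨ ℕ.*-assoc (suc q) (binom (suc q) v) (binom u j) ⟩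
      suc q * (binom (suc q) v * binom u j)          ∎) ⟩
    (4 * q + 2) * (X * Y) + 4 * (suc q * (binom (suc q) v * binom u j)) ∎
    where
    u v L₁ L₂ X Y Z : ℕ
    u = suc (j + q)
    v = u + j
    L₁ = binom (suc q) (suc (suc v))
    L₂ = binom (suc u) (suc j)
    X = binom q (suc v)
    Y = binom u (suc j)
    Z = binom q (suc (suc v))
    l₁ : ∀ a b c d → a * (b * (c * d)) ≡ (b * c) * (a * d)
    l₁ = ℕ-Solver.solve-∀
    l₂ : ∀ a b c d → (a * b) * (c * d) ≡ a * (c * b) * d
    l₂ = ℕ-Solver.solve-∀
    l₃ : ∀ q j X Y →
      suc (q + suc (suc (suc (j + q) + j))) * (suc (q + suc (suc (j + q) + j)) * X) * Y ≡
      suc (suc (j + q)) * ((4 * q + 2) * (X * Y) + 4 * (suc j * (X * Y)))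
    l₃ = ℕ-Solver.solve-∀
    l₄ : ∀ a b c → a * (b * c) ≡ b * (a * c)
    l₄ = ℕ-Solver.solve-∀
    l₅ : ∀ a b c → a * (b * c) ≡ (b * a) * c
    l₅ = ℕ-Solver.solve-∀

-- The difference operator with ratio 4

module _ where
  open import Data.Integer.Base using (_+_; _*_; _-_)
  open ≡ using (refl; sym; trans)
  open ≡.≡-Reasoning

  -- Multiplication by 1 - 4st on the coefficients along a diagonal.
  Δ : (ℕ → ℤ) → ℕ → ℤ
  Δ f j = f (suc j) - + 4 * f j

  Δ^ : ℕ → (ℕ → ℤ) → ℕ → ℤ
  Δ^ zero    f = f
  Δ^ (suc i) f = Δ^ i (Δ f)

  Δ^-suc : ∀ i f j → Δ^ i (f ∘ suc) j ≡ Δ^ i f (suc j)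
  Δ^-suc zero    f j = refl
  Δ^-suc (suc i) f j = Δ^-suc i (Δ f) j

  -- Proportional sequences have proportional iterates; the factors stay on both
  -- sides because ℤ has no division.
  Δ^-scale : ∀ i a b {f g} → (∀ j → a * f j ≡ b * g j) → ∀ j → a * Δ^ i f j ≡ b * Δ^ i g j
  Δ^-scale zero    a b h = h
  Δ^-scale (suc i) a b {f} {g} h = Δ^-scale i a b {Δ f} {Δ g} λ j → begin
    a * (f (suc j) - + 4 * f j)       ≡⟨ l a (f (suc j)) (f j) ⟩
    a * f (suc j) - + 4 * (a * f j)   ≡⟨ cong₂ (λ x y → x - + 4 * y) (h (suc j)) (h j) ⟩
    b * g (suc j) - + 4 * (b * g j)   ≡⟨ l b (g (suc j)) (g j) ⟨
    b * (g (suc j) - + 4 * g j)       ∎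
    where
    l : ∀ a x y → a * (x - + 4 * y) ≡ a * x - + 4 * (a * y)
    l = ℤ-Solver.solve-∀

  -- The coefficient of s^(j+p) t^j in 1 / (1 - s - t)^(p+1).
  T : ℕ → ℕ → ℤ
  T p j = + trinom p (j ℕ.+ p) j

  ΔT : ∀ q j → + suc q * Δ (T (suc q)) j ≡ + (4 ℕ.* q ℕ.+ 2) * T q (suc j)
  ΔT q j = begin
    + suc q * (T (suc q) (suc j) - + 4 * T (suc q) j)
      ≡⟨ l (+ suc q) (T (suc q) (suc j)) (T (suc q) j) ⟩
    + suc q * T (suc q) (suc j) - + 4 * (+ suc q * T (suc q) j)
      ≡⟨ cong₂ (λ x y → x - + 4 * y) step (sym (ℤ.pos-* (suc q) _)) ⟩
    (r + + 4 * s) - + 4 * s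
      ≡⟨ l′ r s ⟩
    r ≡⟨ ℤ.pos-* (4 ℕ.* q ℕ.+ 2) _ ⟩
    + (4 ℕ.* q ℕ.+ 2) * T q (suc j) ∎
    where
    r s : ℤ
    r = + ((4 ℕ.* q ℕ.+ 2) ℕ.* trinom q (suc j ℕ.+ q) (suc j))
    s = + (suc q ℕ.* trinom (suc q) (j ℕ.+ suc q) j)
    step : + suc q * T (suc q) (suc j) ≡ r + + 4 * s
    step = trans (sym (ℤ.pos-* (suc q) _))
      (trans (cong +_ (trinom-step q j))
        (cong (λ k → r + k) (ℤ.pos-* 4 (suc q ℕ.* trinom (suc q) (j ℕ.+ suc q) j))))
    l : ∀ a x y → a * (x - + 4 * y) ≡ a * x - + 4 * (a * y)
    l = ℤ-Solver.solve-∀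
    l′ : ∀ r s → (r + + 4 * s) - + 4 * s ≡ r
    l′ = ℤ-Solver.solve-∀

  Δ^T : ∀ p j → Δ^ p (T p) j ≡ + (binom p p ℕ.* binom (j ℕ.+ p) (j ℕ.+ p))
  Δ^T zero    j rewrite ℕ.+-identityʳ j = refl
  Δ^T (suc q) j = ℤ.*-cancelˡ-≡ (+ suc q) _ _ (begin
    + suc q * Δ^ q (Δ (T (suc q))) j               ≡⟨ Δ^-scale q (+ suc q) (+ r) (ΔT q) j ⟩
    + r * Δ^ q (T q ∘ suc) j                       ≡⟨ cong (+ r *_) (trans (Δ^-suc q (T q) j) (Δ^T q (suc j))) ⟩
    + r * + (binom q q ℕ.* c)                      ≡⟨ ℤ.pos-* r _ ⟨
    + (r ℕ.* (binom q q ℕ.* c))                    ≡⟨ cong +_ (ℕ.*-assoc r (binom q q) c) ⟨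
    + (r ℕ.* binom q q ℕ.* c)                      ≡⟨ cong (λ k → + (k ℕ.* c)) (central-suc q) ⟨
    + (suc q ℕ.* b ℕ.* c)                          ≡⟨ cong +_ (ℕ.*-assoc (suc q) b c) ⟩
    + (suc q ℕ.* (b ℕ.* c))                        ≡⟨ ℤ.pos-* (suc q) _ ⟩
    + suc q * + (b ℕ.* c)                          ≡⟨ cong (λ k → + suc q * + (b ℕ.* binom k k)) (ℕ.+-suc j q) ⟨
    + suc q * + (b ℕ.* binom (j ℕ.+ suc q) (j ℕ.+ suc q)) ∎)
    where
    r b c : ℕ
    r = 4 ℕ.* q ℕ.+ 2
    b = binom (suc q) (suc q)
    c = binom (suc j ℕ.+ q) (suc j ℕ.+ q)

-- The ring of formal power series

module Expansion {c ℓ₁ ℓ₂} (K : HeytingField c ℓ₁ ℓ₂) where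
  open PowerSeries K
  open Ser using ()
    renaming (_+_ to _⊞_; _*_ to _⊠_; -_ to ⊝_; _×_ to _·_; _^_ to _⊡_; 1# to 𝟙)
  open HeytingCommutativeRing (HeytingField.heytingCommutativeRing K)
    using (commutativeRing)
  private
    module K = CommutativeRing commutativeRing
    module K-Solver = IntegerMultiples.Solver commutativeRing
  open K using
    (refl; sym; trans; +-cong; +-congˡ; +-congʳ; *-cong; *-congˡ; *-congʳ; -‿cong)
  open IntegerMultiples commutativeRing using (fromℤ; fromℤ-+; fromℤ-neg; fromℤ-*)
  open Multiples K.semiring using (×ᵤ≈×)
  open import Algebra.Definitions.RawSemiring (Semiring.rawSemiring K.semiring) using (sum)
  open import Algebra.Properties.CommutativeMonoid.Sum K.+-commutativeMonoid
    using (sum-cong-≋; ∑-distrib-+)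
  open import Algebra.Properties.Semiring.Mult K.semiring
    using (×-homo-+; ×1-homo-*; ×-congˡ; ×-congʳ)
  open import Algebra.Properties.Semiring.Sum K.semiring using (*-distribˡ-sum)
  open SetoidReasoning K.setoid

  -- The sum of H i j over all i + j = a.  By computation, ∑⟨ a ∷ α ⟩ F is such a
  -- sum over the first exponents.
  cauchy : (ℕ → ℕ → Carrier) → ℕ → Carrier
  cauchy H a = sum {suc a} (λ i → H (toℕ i) (a ℕ.∸ toℕ i))

  cauchy-cong : ∀ {G H} → (∀ i j → G i j ≈ H i j) → ∀ a → cauchy G a ≈ cauchy H a
  cauchy-cong {G} {H} G≈H a = sum-cong-≋
    {x = λ i → G (toℕ i) (a ℕ.∸ toℕ i)} {λ i → H (toℕ i) (a ℕ.∸ toℕ i)}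
    (λ (i : Fin (suc a)) → G≈H (toℕ i) (a ℕ.∸ toℕ i))

  cauchy-+ : ∀ G H a → cauchy (λ i j → G i j + H i j) a ≈ cauchy G a + cauchy H a
  cauchy-+ G H a = ∑-distrib-+ {suc a}
    (λ i → G (toℕ i) (a ℕ.∸ toℕ i)) (λ i → H (toℕ i) (a ℕ.∸ toℕ i))

  cauchy-last : ∀ H a → cauchy H (suc a) ≈ cauchy (λ i j → H i (suc j)) a + H (suc a) 0
  cauchy-last H zero    = begin
    H 0 1 + (H 1 0 + 0#)  ≈⟨ +-congˡ (K.+-comm _ _) ⟩
    H 0 1 + (0# + H 1 0)  ≈⟨ K.+-assoc _ _ _ ⟨
    (H 0 1 + 0#) + H 1 0  ∎
  cauchy-last H (suc a) = trans (+-congˡ (cauchy-last (H ∘ suc) a)) (sym (K.+-assoc _ _ _))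

  cauchy-swap : ∀ H a → cauchy H a ≈ cauchy (flip H) a
  cauchy-swap H zero    = refl
  cauchy-swap H (suc a) = begin
    H 0 (suc a) + cauchy (H ∘ suc) a        ≈⟨ K.+-comm _ _ ⟩
    cauchy (H ∘ suc) a + H 0 (suc a)        ≈⟨ +-congʳ (cauchy-swap (H ∘ suc) a) ⟩
    cauchy (flip (H ∘ suc)) a + H 0 (suc a) ≈⟨ cauchy-last (flip H) a ⟨
    cauchy (flip H) (suc a)                 ∎

  -- Both sides are the sum of G i j k over all i + j + k = a.
  cauchy-assoc : ∀ (G : ℕ → ℕ → ℕ → Carrier) a →
    cauchy (λ s k → cauchy (λ i j → G i j k) s) a ≈ cauchy (λ i s → cauchy (G i) s) a
  cauchy-assoc G zero    = refl
  cauchy-assoc G (suc a) = begin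
    (G 0 0 (suc a) + 0#) +
      cauchy (λ s k → G 0 (suc s) k + cauchy (λ i j → G (suc i) j k) s) a
      ≈⟨ +-cong (K.+-identityʳ _) (cauchy-+ (λ s k → G 0 (suc s) k)
           (λ s k → cauchy (λ i j → G (suc i) j k) s) a) ⟩
    G 0 0 (suc a) + (cauchy (λ s k → G 0 (suc s) k) a +
      cauchy (λ s k → cauchy (λ i j → G (suc i) j k) s) a)
      ≈⟨ K.+-assoc _ _ _ ⟨
    cauchy (G 0) (suc a) + cauchy (λ s k → cauchy (λ i j → G (suc i) j k) s) a
      ≈⟨ +-congˡ (cauchy-assoc (G ∘ suc) a) ⟩
    cauchy (G 0) (suc a) + cauchy (λ i s → cauchy (G (suc i)) s) a ∎

  ∑-+ : ∀ {m} (α : Vec ℕ m) F G →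
        ∑⟨ α ⟩ (λ β γ → F β γ + G β γ) ≈ ∑⟨ α ⟩ F + ∑⟨ α ⟩ G
  ∑-+ []      F G = refl
  ∑-+ (a ∷ α) F G = trans
    (cauchy-cong (λ i j → ∑-+ α (λ β γ → F (i ∷ β) (j ∷ γ)) (λ β γ → G (i ∷ β) (j ∷ γ))) a)
    (cauchy-+ (λ i j → ∑⟨ α ⟩ (λ β γ → F (i ∷ β) (j ∷ γ)))
              (λ i j → ∑⟨ α ⟩ (λ β γ → G (i ∷ β) (j ∷ γ))) a)

  ∑-*ˡ : ∀ {m} (α : Vec ℕ m) k F → k * ∑⟨ α ⟩ F ≈ ∑⟨ α ⟩ (λ β γ → k * F β γ)
  ∑-*ˡ []      k F = refl
  ∑-*ˡ (a ∷ α) k F = trans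
    (*-distribˡ-sum {suc a} k (λ i → ∑⟨ α ⟩ (slice F a i)))
    (cauchy-cong (λ i j → ∑-*ˡ α k (λ β γ → F (i ∷ β) (j ∷ γ))) a)

  ∑-swap : ∀ {m} (α : Vec ℕ m) F → ∑⟨ α ⟩ F ≈ ∑⟨ α ⟩ (flip F)
  ∑-swap []      F = refl
  ∑-swap (a ∷ α) F = trans
    (cauchy-swap (λ i j → ∑⟨ α ⟩ (λ β γ → F (i ∷ β) (j ∷ γ))) a)
    (cauchy-cong (λ i j → ∑-swap α (λ β γ → F (j ∷ β) (i ∷ γ))) a)

  ∑-assoc : ∀ {m} (α : Vec ℕ m) (F : Vec ℕ m → Vec ℕ m → Vec ℕ m → Carrier) →
    ∑⟨ α ⟩ (λ β γ → ∑⟨ β ⟩ (λ β₁ β₂ → F β₁ β₂ γ)) ≈ ∑⟨ α ⟩ (λ β γ → ∑⟨ γ ⟩ (F β))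
  ∑-assoc []      F = refl
  ∑-assoc (a ∷ α) F = begin
    cauchy (λ s k → ∑⟨ α ⟩ (λ β γ → cauchy (λ i j → ∑⟨ β ⟩ (λ β₁ β₂ → F (i ∷ β₁) (j ∷ β₂) (k ∷ γ))) s)) a
      ≈⟨ cauchy-cong (λ s k → ∑-sum {n = suc s} α
           (λ i β γ → ∑⟨ β ⟩ (λ β₁ β₂ → F (toℕ i ∷ β₁) (s ℕ.∸ toℕ i ∷ β₂) (k ∷ γ)))) a ⟩
    cauchy (λ s k → cauchy (λ i j → ∑⟨ α ⟩ (λ β γ → ∑⟨ β ⟩ (λ β₁ β₂ → F (i ∷ β₁) (j ∷ β₂) (k ∷ γ)))) s) a
      ≈⟨ cauchy-cong (λ s k → cauchy-cong (λ i j →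
           ∑-assoc α (λ β₁ β₂ γ → F (i ∷ β₁) (j ∷ β₂) (k ∷ γ))) s) a ⟩
    cauchy (λ s k → cauchy (λ i j → G i j k) s) a
      ≈⟨ cauchy-assoc G a ⟩
    cauchy (λ i s → cauchy (G i) s) a
      ≈⟨ cauchy-cong (λ i s → ∑-sum {n = suc s} α
           (λ j β γ → ∑⟨ γ ⟩ (λ γ₁ γ₂ → F (i ∷ β) (toℕ j ∷ γ₁) (s ℕ.∸ toℕ j ∷ γ₂)))) a ⟨
    cauchy (λ i s → ∑⟨ α ⟩ (λ β γ → cauchy (λ j k → ∑⟨ γ ⟩ (λ γ₁ γ₂ → F (i ∷ β) (j ∷ γ₁) (k ∷ γ₂))) s)) a ∎
    where
    G : ℕ → ℕ → ℕ → Carrier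
    G i j k = ∑⟨ α ⟩ (λ β γ → ∑⟨ γ ⟩ (λ γ₁ γ₂ → F (i ∷ β) (j ∷ γ₁) (k ∷ γ₂)))

  module _ (m : ℕ) where
    open Ser {m} using () renaming (_≈_ to _≋_; 0# to 𝟘)

    ⊠-comm : ∀ f g → f ⊠ g ≋ g ⊠ f
    ⊠-comm f g α = trans (∑-swap α (λ β γ → f β * g γ)) (∑-cong α λ β γ _ → K.*-comm _ _)

    ⊠-assoc : ∀ f g h → (f ⊠ g) ⊠ h ≋ f ⊠ (g ⊠ h)
    ⊠-assoc f g h α = begin
      ∑⟨ α ⟩ (λ β γ → (f ⊠ g) β * h γ)
        ≈⟨ ∑-cong α (λ β γ _ → begin
             (f ⊠ g) β * h γ                                ≈⟨ K.*-comm _ _ ⟩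
             h γ * (f ⊠ g) β                                ≈⟨ ∑-*ˡ β (h γ) _ ⟩
             ∑⟨ β ⟩ (λ β₁ β₂ → h γ * (f β₁ * g β₂))
               ≈⟨ ∑-cong β (λ β₁ β₂ _ → trans (K.*-comm _ _) (K.*-assoc _ _ _)) ⟩
             ∑⟨ β ⟩ (λ β₁ β₂ → f β₁ * (g β₂ * h γ))         ∎) ⟩
      ∑⟨ α ⟩ (λ β γ → ∑⟨ β ⟩ (λ β₁ β₂ → f β₁ * (g β₂ * h γ)))
        ≈⟨ ∑-assoc α (λ β γ₁ γ₂ → f β * (g γ₁ * h γ₂)) ⟩
      ∑⟨ α ⟩ (λ β γ → ∑⟨ γ ⟩ (λ γ₁ γ₂ → f β * (g γ₁ * h γ₂)))
        ≈⟨ ∑-cong α (λ β γ _ → ∑-*ˡ γ (f β) _) ⟨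
      ∑⟨ α ⟩ (λ β γ → f β * (g ⊠ h) γ) ∎

    ⊠-identityˡ : ∀ f → 𝟙 ⊠ f ≋ f
    ⊠-identityˡ = 1*f≈f

    ⊠-distribˡ-⊞ : ∀ f g h → f ⊠ (g ⊞ h) ≋ f ⊠ g ⊞ f ⊠ h
    ⊠-distribˡ-⊞ f g h α =
      trans (∑-cong α λ β γ _ → K.distribˡ _ _ _) (∑-+ α _ _)

    ⊞-isAbelianGroup : IsAbelianGroup _≋_ _⊞_ 𝟘 ⊝_
    ⊞-isAbelianGroup = record
      { isGroup = record
        { isMonoid = record
          { isSemigroup = record
            { isMagma = record
              { isEquivalence = record
                { refl  = λ α → refl
                ; sym   = λ p α → sym (p α)
                ; trans = λ p q α → trans (p α) (q α)
                }
              ; ∙-cong = λ p q α → +-cong (p α) (q α)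
              }
            ; assoc = λ f g h α → K.+-assoc _ _ _
            }
          ; identity = (λ f α → K.+-identityˡ _) , (λ f α → K.+-identityʳ _)
          }
        ; inverse = (λ f α → K.-‿inverseˡ _) , (λ f α → K.-‿inverseʳ _)
        ; ⁻¹-cong = λ p α → K.-‿cong (p α)
        }
      ; comm = λ f g α → K.+-comm _ _
      }

    seriesRing : CommutativeRing c ℓ₁
    seriesRing = record
      { Carrier = Series m
      ; isCommutativeRing = record
        { isRing = record
          { +-isAbelianGroup = ⊞-isAbelianGroup
          ; *-cong = λ p q α → ∑-cong α λ β γ _ → *-cong (p β) (q γ)
          ; *-assoc = ⊠-assoc
          ; *-identity = ⊠-identityˡ
                       , λ f α → trans (⊠-comm f 𝟙 α) (⊠-identityˡ f α)
          ; distrib = ⊠-distribˡ-⊞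
                    , λ h f g α → begin
                        ((f ⊞ g) ⊠ h) α        ≈⟨ ⊠-comm (f ⊞ g) h α ⟩
                        (h ⊠ (f ⊞ g)) α        ≈⟨ ⊠-distribˡ-⊞ h f g α ⟩
                        (h ⊠ f) α + (h ⊠ g) α  ≈⟨ +-cong (⊠-comm h f α) (⊠-comm h g α) ⟩
                        (f ⊠ h) α + (g ⊠ h) α  ∎
          }
        ; *-comm = ⊠-comm
        }
      }

  private
    module S {m} = CommutativeRing (seriesRing m)
    module S-Solver {m} = IntegerMultiples.Solver (seriesRing m)

  -- f = f (Q (1/Q)) = (f Q) (1/Q) = 1/Q.
  inverse-unique : ∀ {m} (Q f : Series m) (Q₀#0 : coeff 𝟎 Q # 0#) →
    Q ⊠ f S.≈ 𝟙 → f S.≈ 1/ Q ⟨ Q₀#0 ⟩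
  inverse-unique Q f Q₀#0 Qf≈1 α = begin
    f α              ≈⟨ S.*-identityʳ f α ⟨
    (f ⊠ 𝟙) α        ≈⟨ S.*-congˡ {x = f} (Q*1/Q≈1 Q Q₀#0) α ⟨
    (f ⊠ (Q ⊠ Q⁻¹)) α  ≈⟨ S.*-assoc f Q Q⁻¹ α ⟨
    ((f ⊠ Q) ⊠ Q⁻¹) α  ≈⟨ S.*-congʳ {x = Q⁻¹} {f ⊠ Q} {𝟙} (λ β → trans (S.*-comm f Q β) (Qf≈1 β)) α ⟩
    (𝟙 ⊠ Q⁻¹) α      ≈⟨ S.*-identityˡ Q⁻¹ α ⟩
    Q⁻¹ α            ∎
    where Q⁻¹ = 1/ Q ⟨ Q₀#0 ⟩

  -- Multiplication by a variable

  var₀-zero : ∀ {m} (f : Series (suc m)) α → (var 0F ⊠ f) (0 ∷ α) ≈ 0#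
  var₀-zero f α = trans (K.+-identityʳ _) (∑-zero α _ λ _ _ _ → K.zeroˡ _)

  var₀-suc : ∀ {m} (f : Series (suc m)) a α → (var 0F ⊠ f) (suc a ∷ α) ≈ f (a ∷ α)
  var₀-suc f a α = trans (+-cong (∑-zero α _ λ _ _ _ → K.zeroˡ _) (1*f≈f f (a ∷ α))) (K.+-identityˡ _)

  var-suc : ∀ {m} (i : Fin m) (f : Series (suc m)) a α →
            (var (Fin.suc i) ⊠ f) (a ∷ α) ≈ (var i ⊠ (f ∘ (a ∷_))) α
  var-suc i f a α = trans
    (+-congˡ (sum-zero {a} _ λ _ → ∑-zero α _ λ _ _ _ → K.zeroˡ _))
    (K.+-identityʳ _)

  var-cong : ∀ {m} (i : Fin m) {f g : Series m} → f S.≈ g → var i ⊠ f S.≈ var i ⊠ g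
  var-cong i {f} {g} = S.*-congˡ {x = var i} {f} {g}

  -- Products with the polynomials below, written with products by one variable at
  -- a time, whose coefficients are the shifts above.
  module _ {m : ℕ} (u v : Series m) where
    1-u-v-expand : ∀ f → (𝟙 ⊞ ⊝ u ⊞ ⊝ v) ⊠ f S.≈ f ⊞ ⊝ (u ⊠ f) ⊞ ⊝ (v ⊠ f)
    1-u-v-expand = let open S-Solver in
      solve 3 (λ u v f → (con (+ 1) :- u :- v) :* f := f :- u :* f :- v :* f) S.refl u v

    1-4uv-expand : ∀ f → (𝟙 ⊞ ⊝ (4 · (u ⊠ v))) ⊠ f S.≈ f ⊞ ⊝ (4 · (v ⊠ (u ⊠ f)))
    1-4uv-expand = let open S-Solver in
      solve 3 (λ u v f → (con (+ 1) :- 4 :× (u :* v)) :* f := f :- 4 :× (v :* (u :* f))) S.refl u v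

    Q-expand : ∀ w f → (𝟙 ⊞ ⊝ (w ⊠ (𝟙 ⊞ ⊝ (4 · (u ⊠ v)))) ⊞ ⊝ u ⊞ ⊝ v) ⊠ f S.≈
      f ⊞ ⊝ (w ⊠ f) ⊞ 4 · (u ⊠ (v ⊠ (w ⊠ f))) ⊞ ⊝ (u ⊠ f) ⊞ ⊝ (v ⊠ f)
    Q-expand = let open S-Solver in
      solve 4 (λ u v w f →
        (con (+ 1) :- w :* (con (+ 1) :- 4 :× (u :* v)) :- u :- v) :* f :=
        f :- w :* f :+ 4 :× (u :* (v :* (w :* f))) :- u :* f :- v :* f) S.refl u v

  -- Powers of 1 / (1 - s - t)

  -- The series in s = var 0F and t = var 1F with a given table of coefficients.
  fromℕ² : (ℕ → ℕ → ℕ) → Series 2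
  fromℕ² f (m ∷ d ∷ []) = f m d × 1#

  s*-fromℕ² : ∀ f → var 0F ⊠ fromℕ² f S.≈ fromℕ² (shiftˡ f)
  s*-fromℕ² f (zero  ∷ d ∷ []) = var₀-zero (fromℕ² f) (d ∷ [])
  s*-fromℕ² f (suc m ∷ d ∷ []) = var₀-suc (fromℕ² f) m (d ∷ [])

  t*-fromℕ² : ∀ f → var 1F ⊠ fromℕ² f S.≈ fromℕ² (shiftʳ f)
  t*-fromℕ² f (m ∷ zero  ∷ []) = trans (var-suc 0F (fromℕ² f) m (0 ∷ [])) (var₀-zero (fromℕ² f ∘ (m ∷_)) [])
  t*-fromℕ² f (m ∷ suc d ∷ []) = trans (var-suc 0F (fromℕ² f) m (suc d ∷ [])) (var₀-suc (fromℕ² f ∘ (m ∷_)) d [])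

  -- V = 1 - s - t and W = 1 - 4st.
  V W : Series 2
  V = 𝟙 ⊞ ⊝ var 0F ⊞ ⊝ var 1F
  W = 𝟙 ⊞ ⊝ (4 · (var 0F ⊠ var 1F))

  V*-fromℕ² : ∀ f g → (∀ m d → f m d ≡ g m d ℕ.+ shiftˡ f m d ℕ.+ shiftʳ f m d) →
    V ⊠ fromℕ² f S.≈ fromℕ² g
  V*-fromℕ² f g h α@(m ∷ d ∷ []) = begin
    (V ⊠ F) α                                     ≈⟨ 1-u-v-expand (var 0F) (var 1F) F α ⟩
    F α - (var 0F ⊠ F) α - (var 1F ⊠ F) α         ≈⟨ +-cong (+-cong split (-‿cong (s*-fromℕ² f α))) (-‿cong (t*-fromℕ² f α)) ⟩
    (G + A + B) - A - B                           ≈⟨ cancel G A B ⟩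
    G                                             ∎
    where
    F = fromℕ² f
    G A B : Carrier
    G = g m d × 1#
    A = shiftˡ f m d × 1#
    B = shiftʳ f m d × 1#
    split : F α ≈ G + A + B
    split = trans (×-congˡ (h m d)) (trans (×-homo-+ 1# (g m d ℕ.+ shiftˡ f m d) _)
      (+-congʳ (×-homo-+ 1# (g m d) _)))
    cancel : ∀ G A B → (G + A + B) - A - B ≈ G
    cancel = let open K-Solver in solve 3 (λ G A B → (G :+ A :+ B) :- A :- B := G) refl

  -- E p is 1 / V^(p+1).
  E : ℕ → Series 2
  E p = fromℕ² (trinom p)

  V*E-suc : ∀ p → V ⊠ E (suc p) S.≈ E p
  V*E-suc p = V*-fromℕ² (trinom (suc p)) (trinom p) (trinom-pascal p)

  V*E-zero : V ⊠ E 0 S.≈ 𝟙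
  V*E-zero α = trans (V*-fromℕ² (trinom 0) δ pascal α) (δ≈𝟙 α)
    where
    δ : ℕ → ℕ → ℕ
    δ zero    zero    = 1
    δ zero    (suc d) = 0
    δ (suc m) d       = 0
    pascal : ∀ m d → trinom 0 m d ≡ δ m d ℕ.+ shiftˡ (trinom 0) m d ℕ.+ shiftʳ (trinom 0) m d
    pascal zero    zero    = ≡.refl
    pascal zero    (suc d) = ≡.refl
    pascal (suc m) zero    rewrite binom-zeroʳ m = ≡.refl
    pascal (suc m) (suc d) = l (binom m (suc d)) (binom (suc m) d)
      where
      l : ∀ a b → 1 ℕ.* (a ℕ.+ b) ≡ 1 ℕ.* a ℕ.+ 1 ℕ.* b
      l = ℕ-Solver.solve-∀
    δ≈𝟙 : fromℕ² δ S.≈ 𝟙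
    δ≈𝟙 (zero  ∷ zero  ∷ []) = K.+-identityʳ 1#
    δ≈𝟙 (zero  ∷ suc d ∷ []) = refl
    δ≈𝟙 (suc m ∷ d     ∷ []) = refl

  -- The coefficient W^p / V^(p+1) of z^p in 1 / (V - z W).
  g : ℕ → Series 2
  g p = (W ⊡ p) ⊠ E p

  *-pull : ∀ {m} (a b c : Series m) → a ⊠ (b ⊠ c) S.≈ b ⊠ (a ⊠ c)
  *-pull = let open S-Solver in solve 3 (λ a b c → a :* (b :* c) := b :* (a :* c)) S.refl

  V*g-zero : V ⊠ g 0 S.≈ 𝟙
  V*g-zero α = begin
    (V ⊠ (𝟙 ⊠ E 0)) α   ≈⟨ *-pull V 𝟙 (E 0) α ⟩
    (𝟙 ⊠ (V ⊠ E 0)) α   ≈⟨ S.*-identityˡ (V ⊠ E 0) α ⟩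
    (V ⊠ E 0) α         ≈⟨ V*E-zero α ⟩
    𝟙 α                 ∎

  V*g-suc : ∀ p → V ⊠ g (suc p) S.≈ W ⊠ g p
  V*g-suc p α = begin
    (V ⊠ ((W ⊡ suc p) ⊠ E (suc p))) α   ≈⟨ *-pull V (W ⊡ suc p) (E (suc p)) α ⟩
    ((W ⊡ suc p) ⊠ (V ⊠ E (suc p))) α   ≈⟨ S.*-congˡ {x = W ⊡ suc p} (V*E-suc p) α ⟩
    ((W ⊠ (W ⊡ p)) ⊠ E p) α             ≈⟨ S.*-assoc W (W ⊡ p) (E p) α ⟩
    (W ⊠ g p) α                         ∎

  -- The inverse of V - z W, and the substitution of x + y for s

  -- Q₁ with a single variable s in place of x + y.  The variables are z = var 0F,
  -- s = var 1F and t = var 2F; with z first, fixing the exponent of z leaves a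
  -- series in s and t.
  Q₀ : Series 3
  Q₀ = 𝟙 ⊞ ⊝ (var 1F ⊠ (𝟙 ⊞ ⊝ (4 · (var 0F ⊠ var 2F)))) ⊞ ⊝ var 0F ⊞ ⊝ var 2F

  -- 1 / Q₀, expanded in powers of z.
  G : Series 3
  G (p ∷ α) = g p α

  -- The coefficient of z^(p+1) on the left is V g (p+1) - W g p.
  Q₀*G≈1 : Q₀ ⊠ G S.≈ 𝟙
  Q₀*G≈1 (zero ∷ α) = begin
    (Q₀ ⊠ G) (0 ∷ α)
      ≈⟨ Q-expand (var 0F) (var 2F) (var 1F) G (0 ∷ α) ⟩
    g 0 α - (var 1F ⊠ G) (0 ∷ α) + 4 × (var 0F ⊠ X) (0 ∷ α) - (var 0F ⊠ G) (0 ∷ α) - (var 2F ⊠ G) (0 ∷ α)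
      ≈⟨ +-cong (+-cong (+-cong (+-congˡ (-‿cong (var-suc 0F G 0 α)))
           (×-congʳ 4 (var₀-zero X α))) (-‿cong (var₀-zero G α))) (-‿cong (var-suc 1F G 0 α)) ⟩
    g 0 α - (var 0F ⊠ g 0) α + 4 × 0# - 0# - (var 1F ⊠ g 0) α
      ≈⟨ drop (g 0 α) ((var 0F ⊠ g 0) α) ((var 1F ⊠ g 0) α) ⟩
    g 0 α - (var 0F ⊠ g 0) α - (var 1F ⊠ g 0) α
      ≈⟨ 1-u-v-expand (var 0F) (var 1F) (g 0) α ⟨
    (V ⊠ g 0) α
      ≈⟨ V*g-zero α ⟩
    𝟙 α ∎
    where
    X = var 2F ⊠ (var 1F ⊠ G)
    drop : ∀ a b c → a - b + 4 × 0# - 0# - c ≈ a - b - c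
    drop = let open K-Solver in
      solve 3 (λ a b c → a :- b :+ 4 :× con (+ 0) :- con (+ 0) :- c := a :- b :- c) refl
  Q₀*G≈1 (suc p ∷ α) = begin
    (Q₀ ⊠ G) (suc p ∷ α)
      ≈⟨ Q-expand (var 0F) (var 2F) (var 1F) G (suc p ∷ α) ⟩
    g′ α - (var 1F ⊠ G) (suc p ∷ α) + 4 × (var 0F ⊠ X) (suc p ∷ α)
      - (var 0F ⊠ G) (suc p ∷ α) - (var 2F ⊠ G) (suc p ∷ α)
      ≈⟨ +-cong (+-cong (+-cong (+-congˡ (-‿cong (var-suc 0F G (suc p) α)))
           (×-congʳ 4 (trans (var₀-suc X p α) X-slice)))
           (-‿cong (var₀-suc G p α))) (-‿cong (var-suc 1F G (suc p) α)) ⟩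
    g′ α - (var 0F ⊠ g′) α + 4 × Y - g p α - (var 1F ⊠ g′) α
      ≈⟨ regroup (g′ α) ((var 0F ⊠ g′) α) ((var 1F ⊠ g′) α) Y (g p α) ⟩
    (g′ α - (var 0F ⊠ g′) α - (var 1F ⊠ g′) α) - (g p α - 4 × Y)
      ≈⟨ +-cong (1-u-v-expand (var 0F) (var 1F) g′ α) (-‿cong (1-4uv-expand (var 0F) (var 1F) (g p) α)) ⟨
    (V ⊠ g′) α - (W ⊠ g p) α
      ≈⟨ +-congʳ (V*g-suc p α) ⟩
    (W ⊠ g p) α - (W ⊠ g p) α
      ≈⟨ K.-‿inverseʳ _ ⟩
    0# ∎
    where
    g′ = g (suc p)
    X = var 2F ⊠ (var 1F ⊠ G)
    Y = (var 1F ⊠ (var 0F ⊠ g p)) α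
    X-slice : X (p ∷ α) ≈ Y
    X-slice = trans (var-suc 1F (var 1F ⊠ G) p α) (var-cong 1F (var-suc 0F G p) α)
    regroup : ∀ a b c y d → a - b + 4 × y - d - c ≈ (a - b - c) - (d - 4 × y)
    regroup = let open K-Solver in
      solve 5 (λ a b c y d → a :- b :+ 4 :× y :- d :- c := (a :- b :- c) :- (d :- 4 :× y)) refl

  -- The substitution of x + y for s, from series in z, s, t to series in
  -- x, y, z, t: the coefficient of x^a y^b in (x + y)^m is binom a b if m = a + b.
  σ : Series 3 → Series 4
  σ f (a ∷ b ∷ p ∷ d ∷ []) = binom a b × 1# * f (p ∷ a ℕ.+ b ∷ d ∷ [])

  σ-cong : ∀ {f g} → f S.≈ g → σ f S.≈ σ g
  σ-cong h (a ∷ b ∷ p ∷ d ∷ []) = *-congˡ (h _)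

  σ-1 : σ 𝟙 S.≈ 𝟙
  σ-1 (zero  ∷ zero  ∷ p     ∷ d ∷ []) = trans (*-congʳ (K.+-identityʳ 1#)) (K.*-identityˡ _)
  σ-1 (zero  ∷ suc b ∷ zero  ∷ d ∷ []) = K.zeroʳ _
  σ-1 (zero  ∷ suc b ∷ suc p ∷ d ∷ []) = K.zeroʳ _
  σ-1 (suc a ∷ b     ∷ zero  ∷ d ∷ []) = K.zeroʳ _
  σ-1 (suc a ∷ b     ∷ suc p ∷ d ∷ []) = K.zeroʳ _

  -- In positive degrees this is Pascal's rule.
  σ-s : ∀ f → (x ⊞ y) ⊠ σ f S.≈ σ (var 1F ⊠ f)
  σ-s f (a ∷ b ∷ p ∷ d ∷ []) = trans (S.distribʳ (σ f) x y (a ∷ b ∷ p ∷ d ∷ []))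
    (trans (+-congˡ (var-suc 0F (σ f) a (b ∷ p ∷ d ∷ [])))
    (trans (cases a b) (*-congˡ (sym (var-suc 0F f p (a ℕ.+ b ∷ d ∷ []))))))
    where
    F : Series 2
    F = f ∘ (p ∷_)
    cases : ∀ a b →
      (x ⊠ σ f) (a ∷ b ∷ p ∷ d ∷ []) + (var 0F ⊠ (σ f ∘ (a ∷_))) (b ∷ p ∷ d ∷ []) ≈
      binom a b × 1# * (var 0F ⊠ F) (a ℕ.+ b ∷ d ∷ [])
    cases zero    zero    = trans (+-cong (var₀-zero (σ f) (0 ∷ p ∷ d ∷ [])) (var₀-zero (σ f ∘ (0 ∷_)) (p ∷ d ∷ [])))
      (trans (K.+-identityˡ 0#) (sym (trans (*-congˡ (var₀-zero F (d ∷ []))) (K.zeroʳ _))))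
    cases zero    (suc b) = trans (+-cong (var₀-zero (σ f) (suc b ∷ p ∷ d ∷ []))
                                    (var₀-suc (σ f ∘ (0 ∷_)) b (p ∷ d ∷ [])))
      (trans (K.+-identityˡ _) (*-congˡ (sym (var₀-suc F b (d ∷ [])))))
    cases (suc a) zero    = trans (+-cong (var₀-suc (σ f) a (0 ∷ p ∷ d ∷ []))
                                    (var₀-zero (σ f ∘ (suc a ∷_)) (p ∷ d ∷ [])))
      (trans (K.+-identityʳ _) (*-cong (×-congˡ (binom-zeroʳ a)) (sym (var₀-suc F (a ℕ.+ 0) (d ∷ [])))))
    cases (suc a) (suc b) = begin
      (x ⊠ σ f) (suc a ∷ suc b ∷ p ∷ d ∷ []) + (var 0F ⊠ (σ f ∘ (suc a ∷_))) (suc b ∷ p ∷ d ∷ [])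
        ≈⟨ +-cong (var₀-suc (σ f) a (suc b ∷ p ∷ d ∷ [])) (var₀-suc (σ f ∘ (suc a ∷_)) b (p ∷ d ∷ [])) ⟩
      binom a (suc b) × 1# * F (a ℕ.+ suc b ∷ d ∷ []) + binom (suc a) b × 1# * F (suc a ℕ.+ b ∷ d ∷ [])
        ≡⟨ cong (λ n → binom a (suc b) × 1# * F (a ℕ.+ suc b ∷ d ∷ []) +
                         binom (suc a) b × 1# * F (n ∷ d ∷ [])) (ℕ.+-suc a b) ⟨
      binom a (suc b) × 1# * F (a ℕ.+ suc b ∷ d ∷ []) + binom (suc a) b × 1# * F (a ℕ.+ suc b ∷ d ∷ [])
        ≈⟨ K.distribʳ _ _ _ ⟨
      (binom a (suc b) × 1# + binom (suc a) b × 1#) * F (a ℕ.+ suc b ∷ d ∷ [])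
        ≈⟨ *-cong (sym (×-homo-+ 1# (binom a (suc b)) _)) (sym (var₀-suc F (a ℕ.+ suc b) (d ∷ []))) ⟩
      binom (suc a) (suc b) × 1# * (var 0F ⊠ F) (suc a ℕ.+ suc b ∷ d ∷ []) ∎

  σ-z : ∀ f → z ⊠ σ f S.≈ σ (var 0F ⊠ f)
  σ-z f (a ∷ b ∷ p ∷ d ∷ []) = trans (var-suc 1F (σ f) a (b ∷ p ∷ d ∷ []))
    (trans (var-suc 0F (σ f ∘ (a ∷_)) b (p ∷ d ∷ [])) (cases p))
    where
    cases : ∀ p → (var 0F ⊠ (λ γ → σ f (a ∷ b ∷ γ))) (p ∷ d ∷ []) ≈
                  binom a b × 1# * (var 0F ⊠ f) (p ∷ a ℕ.+ b ∷ d ∷ [])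
    cases zero    = trans (var₀-zero (λ γ → σ f (a ∷ b ∷ γ)) (d ∷ []))
      (sym (trans (*-congˡ (var₀-zero f (a ℕ.+ b ∷ d ∷ []))) (K.zeroʳ _)))
    cases (suc p) = trans (var₀-suc (λ γ → σ f (a ∷ b ∷ γ)) p (d ∷ []))
      (*-congˡ (sym (var₀-suc f p (a ℕ.+ b ∷ d ∷ []))))

  σ-t : ∀ f → t ⊠ σ f S.≈ σ (var 2F ⊠ f)
  σ-t f (a ∷ b ∷ p ∷ d ∷ []) = begin
    (t ⊠ σ f) (a ∷ b ∷ p ∷ d ∷ [])                     ≈⟨ var-suc 2F (σ f) a (b ∷ p ∷ d ∷ []) ⟩
    (var 2F ⊠ (σ f ∘ (a ∷_))) (b ∷ p ∷ d ∷ [])         ≈⟨ var-suc 1F (σ f ∘ (a ∷_)) b (p ∷ d ∷ []) ⟩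
    (var 1F ⊠ (λ γ → σ f (a ∷ b ∷ γ))) (p ∷ d ∷ [])    ≈⟨ var-suc 0F (λ γ → σ f (a ∷ b ∷ γ)) p (d ∷ []) ⟩
    (var 0F ⊠ l) (d ∷ [])                              ≈⟨ cases d ⟩
    k * (var 0F ⊠ r) (d ∷ [])                          ≈⟨ *-congˡ (var-suc 0F (f ∘ (p ∷_)) (a ℕ.+ b) (d ∷ [])) ⟨
    k * (var 1F ⊠ (f ∘ (p ∷_))) (a ℕ.+ b ∷ d ∷ [])     ≈⟨ *-congˡ (var-suc 1F f p (a ℕ.+ b ∷ d ∷ [])) ⟨
    k * (var 2F ⊠ f) (p ∷ a ℕ.+ b ∷ d ∷ [])            ∎
    where
    k = binom a b × 1#
    l : Series 1
    l γ = σ f (a ∷ b ∷ p ∷ γ)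
    r : Series 1
    r γ = f (p ∷ a ℕ.+ b ∷ γ)
    cases : ∀ d → (var 0F ⊠ l) (d ∷ []) ≈ k * (var 0F ⊠ r) (d ∷ [])
    cases zero    = trans (var₀-zero l []) (sym (trans (*-congˡ (var₀-zero r [])) (K.zeroʳ _)))
    cases (suc d) = trans (var₀-suc l d []) (*-congˡ (sym (var₀-suc r d [])))

  σ-linear : ∀ f u v w z α →
    σ f α - σ u α + 4 × σ v α - σ w α - σ z α ≈ σ (f ⊞ ⊝ u ⊞ 4 · v ⊞ ⊝ w ⊞ ⊝ z) α
  σ-linear f u v w z (a ∷ b ∷ p ∷ d ∷ []) =
    linear (binom a b × 1#) (f β) (u β) (v β) (w β) (z β)
    where
    β = p ∷ a ℕ.+ b ∷ d ∷ []
    linear : ∀ k f u v w z → k * f - k * u + 4 × (k * v) - k * w - k * z ≈ k * (f - u + 4 × v - w - z)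
    linear = let open K-Solver in
      solve 6 (λ k f u v w z → k :* f :- k :* u :+ 4 :× (k :* v) :- k :* w :- k :* z :=
                               k :* (f :- u :+ 4 :× v :- w :- z)) refl

  σ-zts : ∀ f → z ⊠ (t ⊠ ((x ⊞ y) ⊠ σ f)) S.≈ σ (var 0F ⊠ (var 2F ⊠ (var 1F ⊠ f)))
  σ-zts f α = begin
    (z ⊠ (t ⊠ ((x ⊞ y) ⊠ σ f))) α             ≈⟨ var-cong 2F (var-cong 3F (σ-s f)) α ⟩
    (z ⊠ (t ⊠ σ (var 1F ⊠ f))) α              ≈⟨ var-cong 2F (σ-t (var 1F ⊠ f)) α ⟩
    (z ⊠ σ (var 2F ⊠ (var 1F ⊠ f))) α         ≈⟨ σ-z (var 2F ⊠ (var 1F ⊠ f)) α ⟩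
    σ (var 0F ⊠ (var 2F ⊠ (var 1F ⊠ f))) α    ∎

  -- Substituting x + y for s in Q₀ gives Q₁, and σ is multiplicative in this case.
  Q₁*σ : ∀ f → Q₁ ⊠ σ f S.≈ σ (Q₀ ⊠ f)
  Q₁*σ f α = begin
    (Q₁ ⊠ σ f) α
      ≈⟨ Q-expand z t (x ⊞ y) (σ f) α ⟩
    σ f α - ((x ⊞ y) ⊠ σ f) α + 4 × (z ⊠ (t ⊠ ((x ⊞ y) ⊠ σ f))) α - (z ⊠ σ f) α - (t ⊠ σ f) α
      ≈⟨ +-cong (+-cong (+-cong (+-congˡ (-‿cong (σ-s f α))) (×-congʳ 4 (σ-zts f α)))
           (-‿cong (σ-z f α))) (-‿cong (σ-t f α)) ⟩
    σ f α - σ (var 1F ⊠ f) α + 4 × σ X α - σ (var 0F ⊠ f) α - σ (var 2F ⊠ f) α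
      ≈⟨ σ-linear f (var 1F ⊠ f) X (var 0F ⊠ f) (var 2F ⊠ f) α ⟩
    σ (f ⊞ ⊝ (var 1F ⊠ f) ⊞ 4 · X ⊞ ⊝ (var 0F ⊠ f) ⊞ ⊝ (var 2F ⊠ f)) α
      ≈⟨ σ-cong (Q-expand (var 0F) (var 2F) (var 1F) f) α ⟨
    σ (Q₀ ⊠ f) α ∎
    where X = var 0F ⊠ (var 2F ⊠ (var 1F ⊠ f))

  1/Q₁≈σG : σ G S.≈ 1/ Q₁ ⟨ Q₁#0 ⟩
  1/Q₁≈σG = inverse-unique Q₁ (σ G) Q₁#0 λ α → begin
    (Q₁ ⊠ σ G) α  ≈⟨ Q₁*σ G α ⟩
    σ (Q₀ ⊠ G) α  ≈⟨ σ-cong Q₀*G≈1 α ⟩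
    σ 𝟙 α         ≈⟨ σ-1 α ⟩
    𝟙 α           ∎

  -- Evaluation along the diagonal

  W*-suc : ∀ f m d → (W ⊠ f) (suc m ∷ suc d ∷ []) ≈ f (suc m ∷ suc d ∷ []) - 4 × f (m ∷ d ∷ [])
  W*-suc f m d = trans (1-4uv-expand (var 0F) (var 1F) f (suc m ∷ suc d ∷ []))
    (+-congˡ (-‿cong (×-congʳ 4 (begin
      (var 1F ⊠ sf) (suc m ∷ suc d ∷ [])          ≈⟨ var-suc 0F sf (suc m) (suc d ∷ []) ⟩
      (var 0F ⊠ (sf ∘ (suc m ∷_))) (suc d ∷ [])   ≈⟨ var₀-suc (sf ∘ (suc m ∷_)) d [] ⟩
      sf (suc m ∷ d ∷ [])                         ≈⟨ var₀-suc f m (d ∷ []) ⟩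
      f (m ∷ d ∷ [])                              ∎))))
    where sf = var 0F ⊠ f

  -- If the coefficients of e along the diagonal from s^m t^d are the integers f k,
  -- then the coefficient of W^i e that lies i steps up that diagonal is Δ^ i f 0.
  -- It involves f 0, ..., f i only, so the boundary of the table plays no role.
  W^-diagonal : ∀ i m d e f → (∀ k → e (k ℕ.+ m ∷ k ℕ.+ d ∷ []) ≈ fromℤ (f k)) →
    ((W ⊡ i) ⊠ e) (i ℕ.+ m ∷ i ℕ.+ d ∷ []) ≈ fromℤ (Δ^ i f 0)
  W^-diagonal zero    m d e f h = trans (S.*-identityˡ e (m ∷ d ∷ [])) (h 0)
  W^-diagonal (suc i) m d e f h = begin
    ((W ⊠ (W ⊡ i)) ⊠ e) (suc i ℕ.+ m ∷ suc i ℕ.+ d ∷ [])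
      ≡⟨ cong₂ (λ m d → ((W ⊠ (W ⊡ i)) ⊠ e) (m ∷ d ∷ [])) (ℕ.+-suc i m) (ℕ.+-suc i d) ⟨
    ((W ⊠ (W ⊡ i)) ⊠ e) α
      ≈⟨ trans (S.*-assoc W (W ⊡ i) e α) (*-pull W (W ⊡ i) e α) ⟩
    ((W ⊡ i) ⊠ (W ⊠ e)) α
      ≈⟨ W^-diagonal i (suc m) (suc d) (W ⊠ e) (Δ f) step ⟩
    fromℤ (Δ^ i (Δ f) 0) ∎
    where
    α = i ℕ.+ suc m ∷ i ℕ.+ suc d ∷ []
    step : ∀ k → (W ⊠ e) (k ℕ.+ suc m ∷ k ℕ.+ suc d ∷ []) ≈ fromℤ (Δ f k)
    step k = begin
      (W ⊠ e) (k ℕ.+ suc m ∷ k ℕ.+ suc d ∷ [])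
        ≡⟨ cong₂ (λ m d → (W ⊠ e) (m ∷ d ∷ [])) (ℕ.+-suc k m) (ℕ.+-suc k d) ⟩
      (W ⊠ e) (suc (k ℕ.+ m) ∷ suc (k ℕ.+ d) ∷ [])
        ≈⟨ W*-suc e (k ℕ.+ m) (k ℕ.+ d) ⟩
      e (suc k ℕ.+ m ∷ suc k ℕ.+ d ∷ []) - 4 × e (k ℕ.+ m ∷ k ℕ.+ d ∷ [])
        ≈⟨ +-cong (h (suc k)) (-‿cong (×-congʳ 4 (h k))) ⟩
      fromℤ (f (suc k)) - 4 × fromℤ (f k)
        ≈⟨ +-congˡ (-‿cong (4×≈4* (fromℤ (f k)))) ⟩
      fromℤ (f (suc k)) - fromℤ (+ 4) * fromℤ (f k)
        ≈⟨ +-congˡ (trans (fromℤ-neg (+ 4 ℤ.* f k)) (-‿cong (fromℤ-* (+ 4) (f k)))) ⟨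
      fromℤ (f (suc k)) + fromℤ (ℤ.- (+ 4 ℤ.* f k))
        ≈⟨ fromℤ-+ (f (suc k)) _ ⟨
      fromℤ (Δ f k) ∎
      where
      4×≈4* : ∀ a → 4 × a ≈ fromℤ (+ 4) * a
      4×≈4* = let open K-Solver in solve 1 (λ a → 4 :× a := con (+ 4) :* a) refl

  -- The coefficient of s^(2n) t^n in W^n / V^(n+1) is C(2n, n)².
  g-diagonal : ∀ n → g n (n ℕ.+ n ∷ n ∷ []) ≈ (binom n n ℕ.* binom n n) × 1#
  g-diagonal n = begin
    g n (n ℕ.+ n ∷ n ∷ [])
      ≡⟨ cong (λ d → g n (n ℕ.+ n ∷ d ∷ [])) (ℕ.+-identityʳ n) ⟨
    ((W ⊡ n) ⊠ E n) (n ℕ.+ n ∷ n ℕ.+ 0 ∷ [])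
      ≈⟨ W^-diagonal n n 0 (E n) (T n) (λ k → begin
           trinom n (k ℕ.+ n) (k ℕ.+ 0) × 1#  ≡⟨ cong (λ j → trinom n (k ℕ.+ n) j × 1#) (ℕ.+-identityʳ k) ⟩
           trinom n (k ℕ.+ n) k × 1#          ≈⟨ ×ᵤ≈× (trinom n (k ℕ.+ n) k) 1# ⟩
           fromℤ (T n k)                      ∎) ⟩
    fromℤ (Δ^ n (T n) 0)
      ≡⟨ cong fromℤ (Δ^T n 0) ⟩
    fromℤ (+ (binom n n ℕ.* binom n n))
      ≈⟨ ×ᵤ≈× (binom n n ℕ.* binom n n) 1# ⟨
    (binom n n ℕ.* binom n n) × 1# ∎

  cube≈coeff-1/Q₁ : ∀ n → let α = n ∷ n ∷ n ∷ n ∷ [] in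
    (((2 ℕ.* n) C n) ℕ.^ 3) × 1# ≈ coeff α (1/ Q₁ ⟨ Q₁#0 ⟩)
  cube≈coeff-1/Q₁ n = begin
    (((2 ℕ.* n) C n) ℕ.^ 3) × 1#
      ≡⟨ cong (λ k → (k ℕ.^ 3) × 1#) (≡.trans (binom≡C n n)
           (cong (λ k → (n ℕ.+ k) C n) (≡.sym (ℕ.+-identityʳ n)))) ⟨
    (binom n n ℕ.^ 3) × 1#
      ≡⟨ cong (λ k → (binom n n ℕ.* (binom n n ℕ.* k)) × 1#) (ℕ.*-identityʳ (binom n n)) ⟩
    (binom n n ℕ.* (binom n n ℕ.* binom n n)) × 1#
      ≈⟨ ×1-homo-* (binom n n) _ ⟩
    binom n n × 1# * (binom n n ℕ.* binom n n) × 1#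
      ≈⟨ *-congˡ (g-diagonal n) ⟨
    σ G (n ∷ n ∷ n ∷ n ∷ [])
      ≈⟨ 1/Q₁≈σG (n ∷ n ∷ n ∷ n ∷ []) ⟩
    coeff (n ∷ n ∷ n ∷ n ∷ []) (1/ Q₁ ⟨ Q₁#0 ⟩) ∎

  1/Q₁≈1/Q₂ : 1/ Q₁ ⟨ Q₁#0 ⟩ S.≈ 1/ Q₂ ⟨ Q₂#0 ⟩
  1/Q₁≈1/Q₂ = inverse-unique Q₂ (1/ Q₁ ⟨ Q₁#0 ⟩) Q₂#0 λ α → begin
    (Q₂ ⊠ (1/ Q₁ ⟨ Q₁#0 ⟩)) α
      ≈⟨ S.*-congʳ {x = 1/ Q₁ ⟨ Q₁#0 ⟩} {Q₁} {Q₂} (Determinant.det[I-XM] (seriesRing 4) x y z t) α ⟨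
    (Q₁ ⊠ (1/ Q₁ ⟨ Q₁#0 ⟩)) α
      ≈⟨ Q*1/Q≈1 Q₁ Q₁#0 α ⟩
    𝟙 α ∎

theorem4p3 : ∀ {c ℓ₁ ℓ₂} (K : HeytingField c ℓ₁ ℓ₂) (n : ℕ) →
  let open PowerSeries K
      α = n ∷ n ∷ n ∷ n ∷ []
  in ((((2 ℕ.* n) C n) ℕ.^ 3) × 1# ≈ coeff α (1/ Q₁ ⟨ Q₁#0 ⟩))
     Product.×
     (coeff α (1/ Q₁ ⟨ Q₁#0 ⟩) ≈ coeff α (1/ Q₂ ⟨ Q₂#0 ⟩))
theorem4p3 K n = Expansion.cube≈coeff-1/Q₁ K n , Expansion.1/Q₁≈1/Q₂ K (n ∷ n ∷ n ∷ n ∷ [])
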